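{- For every integer $n\ge 0$ with $n\neq 2$ and every integer $m$, the number of partitions $\vec{\pi}$ of $n$ without repeated odd parts with $\operatorname{M2crank}(\vec{\pi})=m$ equals $M2(m,n)$, where for $n\ne 2$ the integer $M2(m,n)$ is the coefficient of $z^mq^n$ in $$\frac{(-q;q^2)_\infty(q^2;q^2)_\infty}{(zq^2;q^2)_\infty(z^{ -1}q^2;q^2)_\infty}.$$
   Context: Notation: $(a;q)_\infty=\prod_{k=0}^\infty(1-aq^k)$; the generating function is expanded as a formal power series in $q$ whose coefficients are Laurent polynomials in $z$. A partition of $n$ without repeated odd parts is identified with a pair $\vec{\pi}=(\pi_1,\pi_2)\in\mathcal{POD}\times\mathcal{PE}$ with $|\pi_1|+|\pi_2|=n$, where $\mathcal{POD}$ is the set of partitions into distinct odd parts, $\mathcal{PE}$ is the set of partitions into even parts (both including the empty partition $\varnothing$), $|\pi|$ is the sum of the parts of $\pi$, $\pi_1$ consists of the odd parts and $\pi_2$ of the even parts. For a non-empty partition $\pi$, let $\ell(\pi)$ be its largest part, $\omega(\pi)$ the number of ones in $\pi$, and $\mu(\pi)$ the number of parts of $\pi$ larger than $\omega(\pi)$. The crank is $$\operatorname{crank}(\pi)=\begin{cases}\ell(\pi)&\text{if }\omega(\pi)=0,\\ \mu(\pi)-\omega(\pi)&\text{otherwise.}\end{cases}$$ For $\pi\in\mathcal{PE}$, $\frac{\pi}{2}$ denotes the partition obtained by dividing each part of $\pi$ by $2$. For $\pi\in\mathcal{POD}$ define $\theta(\pi)$ as follows. If $\ell(\pi)\ge 5$,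 then $\theta(\pi)=0$ if $\ell(\pi)-2$ is a part of $\pi$, and $\theta(\pi)=1$ otherwise. If $\ell(\pi)\in\{1,3\}$, then $\theta(\pi)=0$ if $1$ is a part of $\pi$, and $\theta(\pi)=1$ otherwise. Also $\theta(\varnothing)=0$. For $\vec\pi=(\pi_1,\pi_2)\in\mathcal{POD}\times\mathcal{PE}$ define $$\operatorname{M2crank}(\vec{\pi})=\begin{cases}\operatorname{crank}\bigl(\frac{\pi_2}{2}\bigr)&\text{if }\pi_2\ne\varnothing,\\ \theta(\pi_1)&\text{if }\pi_2=\varnothing.\end{cases}$$ -}

module Defs where

open import Data.Bool.Base using (if_then_else_)
open import Data.Integer.Base as ℤ using (ℤ; +_; 0ℤ; 1ℤ; -1ℤ)
import Data.Integer.Properties as ℤ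
open import Data.List.Base
  using (List; []; _∷_; _++_; map; filter; length; foldr; upTo; cartesianProductWith)
open import Data.List.Extrema.Nat using (max)
open import Data.List.Relation.Unary.All using (All)
open import Data.List.Relation.Unary.Linked using (Linked)
open import Data.Nat.Base
  using (ℕ; zero; suc; _+_; _∸_; _/_; _<_; _>_; _≥_)
open import Data.Nat.Divisibility using (_∣_; _∤_)
open import Data.Nat.ListAction using (sum)
import Data.Nat.Properties as ℕ
open import Data.List.Membership.DecPropositional ℕ._≟_ using (_∈?_)
open import Data.Product.Base using (Σ-syntax; _×_; _,_)
open import Data.Vec.Base as Vec using (Vec)
open import Relation.Binary.PropositionalEquality.Core using (_≡_)
open import Relation.Nullary.Decidable.Core using (does)

-- A partition is the decreasing list of its parts.  Odd parts are
-- automatically positive.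
record POD : Set where
  constructor pod
  field
    parts      : List ℕ
    decreasing : Linked _>_ parts
    odd        : All (2 ∤_) parts

record PE : Set where
  constructor pe
  field
    parts      : List ℕ
    decreasing : Linked _≥_ parts
    positive   : All (0 <_) parts
    even       : All (2 ∣_) parts

size : POD × PE → ℕ
size (π₁ , π₂) = sum (POD.parts π₁) + sum (PE.parts π₂)

-- The largest part; the default 0 is returned only for the empty partition.
ℓ : List ℕ → ℕ
ℓ = max 0

ω : List ℕ → ℕ
ω π = length (filter (ℕ._≟ 1) π)

μ : List ℕ → ℕ
μ π = length (filter (ω π ℕ.<?_) π)

-- The crank is only meaningful, and only used, for non-empty partitions.
crank : List ℕ → ℤ
crank π = if does (ω π ℕ.≟ 0) then + ℓ π else + μ π ℤ.- + ω π

-- For a non-empty partition into distinct odd parts, ℓ π < 5 means that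
-- ℓ π is 1 or 3.
θ : List ℕ → ℕ
θ []        = 0
θ π@(_ ∷ _) =
  if does (5 ℕ.≤? ℓ π)
  then (if does ((ℓ π ∸ 2) ∈? π) then 0 else 1)
  else (if does (1 ∈? π) then 0 else 1)

M2crank : POD × PE → ℤ
M2crank (π₁ , pe []         _ _ _) = + θ (POD.parts π₁)
M2crank (_  , pe π₂@(_ ∷ _) _ _ _) = crank (map (_/ 2) π₂)

PartitionsWithM2crank : ℤ → ℕ → Set
PartitionsWithM2crank m n = Σ[ π ∈ POD × PE ] (size π ≡ n × M2crank π ≡ m)

-- The pair (c , e) stands for c zᵉ.
Monomial : Set
Monomial = ℤ × ℤ

_*ᴹ_ : Monomial → Monomial → Monomial
(c , e) *ᴹ (d , f) = c ℤ.* d , e ℤ.+ f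

-ᴹ_ : Monomial → Monomial
-ᴹ (c , e) = ℤ.- c , e

-- A Laurent polynomial in z as a formal sum of monomials.  Exponents may repeat
-- and coefficients may vanish, so two representations denote the same Laurent
-- polynomial precisely when they have the same coefficients `coeff`.
Laurent : Set
Laurent = List Monomial

coeff : ℤ → Laurent → ℤ
coeff m []            = 0ℤ
coeff m ((c , e) ∷ p) = (if does (e ℤ.≟ m) then c else 0ℤ) ℤ.+ coeff m p

0ᴸ 1ᴸ : Laurent
0ᴸ = []
1ᴸ = (1ℤ , 0ℤ) ∷ []

infixl 6 _+ᴸ_
infixl 7 _*ᴸ_

_+ᴸ_ _*ᴸ_ : Laurent → Laurent → Laurent
_+ᴸ_ = _++_
_*ᴸ_ = cartesianProductWith _*ᴹ_

-ᴸ_ : Laurent → Laurent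
-ᴸ_ = map -ᴹ_

sumᴸ : List Laurent → Laurent
sumᴸ = foldr _+ᴸ_ 0ᴸ

-- A formal power series in q; the value at n is the coefficient of qⁿ.
Series : Set
Series = ℕ → Laurent

const : Laurent → Series
const a zero    = a
const a (suc _) = 0ᴸ

1ˢ z z⁻¹ q : Series
1ˢ  = const 1ᴸ
z   = const ((1ℤ , 1ℤ) ∷ [])
z⁻¹ = const ((1ℤ , -1ℤ) ∷ [])
q 1 = 1ᴸ
q _ = 0ᴸ

infixl 6 _-ˢ_
infixl 7 _*ˢ_ _/ˢ_
infixr 8 _^ˢ_

-ˢ_ : Series → Series
(-ˢ f) n = -ᴸ f n

_-ˢ_ _*ˢ_ : Series → Series → Series
(f -ˢ g) n = f n +ᴸ (-ᴸ g n)
(f *ˢ g) n = sumᴸ (map (λ i → f i *ᴸ g (n ∸ i)) (upTo (suc n)))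

_^ˢ_ : Series → ℕ → Series
f ^ˢ zero  = 1ˢ
f ^ˢ suc k = f *ˢ f ^ˢ k

-- The inverse g of a series f with constant term 1 is determined by
-- g₀ = 1 and gₙ₊₁ = - (f₁ gₙ + f₂ gₙ₋₁ + ⋯ + fₙ₊₁ g₀);
-- inverseCoeffs f n is the vector gₙ , gₙ₋₁ , … , g₀.
inverseCoeffs : Series → (n : ℕ) → Vec Laurent (suc n)
inverseCoeffs f zero    = 1ᴸ Vec.∷ Vec.[]
inverseCoeffs f (suc n) = (-ᴸ sumᴸ (Vec.toList products)) Vec.∷ gs
  where
  gs       = inverseCoeffs f n
  products = Vec.zipWith (λ i g → f (suc i) *ᴸ g) (Vec.tabulate toℕ) gs
    where open import Data.Fin.Base using (toℕ)

-- Only meaningful when the denominator has constant term 1.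
_/ˢ_ : Series → Series → Series
f /ˢ g = f *ˢ λ n → Vec.head (inverseCoeffs g n)

-- (1 - a) (1 - a b) ⋯ (1 - a bᵏ⁻¹)
pochhammer : Series → Series → ℕ → Series
pochhammer a b zero    = 1ˢ
pochhammer a b (suc k) = pochhammer a b k *ˢ (1ˢ -ˢ a *ˢ b ^ˢ k)

-- (a ; b)∞ for series a and b without constant term.  Then 1 - a bᵏ is 1
-- modulo qᵏ⁺¹, so the factors with k > n do not affect the coefficient of qⁿ.
⟨_⨾_⟩∞ : Series → Series → Series
⟨ a ⨾ b ⟩∞ n = pochhammer a b (suc n) n

q² : Series
q² = q ^ˢ 2

M2GeneratingFunction : Series
M2GeneratingFunction =
  (⟨ -ˢ q ⨾ q² ⟩∞ *ˢ ⟨ q² ⨾ q² ⟩∞) /ˢ (⟨ z *ˢ q² ⨾ q² ⟩∞ *ˢ ⟨ z⁻¹ *ˢ q² ⨾ q² ⟩∞)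

-- The coefficient of zᵐ qⁿ.  It is called M2(m , n) only for n ≢ 2.
M2 : ℤ → ℕ → ℤ
M2 m n = coeff m (M2GeneratingFunction n)

{-# OPTIONS --safe #-}
module Submission where

-- Write Q = q².  By the q-binomial theorem, (Q; Q)∞ / ((z Q; Q)∞ (z⁻¹ Q; Q)∞) is
--   1 - Q + z Q + ∑_{m ≥ 2} zᵐ Qᵐ / (Q²; Q)ₘ₋₁ + ∑_{j ≥ 1} z⁻ʲ Qʲ / ((Q²; Q)ⱼ₋₁ (z Qʲ⁺¹; Q)∞),
-- where the first sum runs over the largest part of a partition without ones and the second over
-- the number of ones.  So it generates the crank, except that the partition of 1 contributes
-- (z - 1 + z⁻¹) Q instead of z⁻¹ Q.  Multiplied by (-q; q²)∞, the surplus (z - 1) Q is what θ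
-- accounts for: a partition into distinct odd parts has θ = 1 precisely when it arises from a
-- non-empty one by increasing the largest part by 2.  The empty one is the exception n = 2.
-- All series are taken modulo a power of q, where Q is nilpotent and sums and products are finite.

-- Both sums come from one expansion, (Q²; Q)∞ / (z⁻¹ Q; Q)∞ = ∑ⱼ (z Q; Q)ⱼ / (Q; Q)ⱼ (z⁻¹ Q)ʲ, the
-- q-binomial theorem with a = z Q and y = z⁻¹ Q, so that a y = Q². Multiply it by (1 - Q) / (z Q;
-- Q)∞. In the terms j ≥ 1 the factor (z Q; Q)ⱼ cancels: parts up to j lose the weight z, just as in
-- μ - ω with ω = j. The term j = 0 is (1 - Q) / (z Q; Q)∞, and a second expansion, with a = 0,
-- turns it into the sum over largest parts. Its first two terms, 1 - Q and z Q, are where the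
-- abnormal partition of 1 originates. The combinatorial obstacle is that a bijection with `Fin k`
-- has to be tied to lists of monomials that represent Laurent polynomials only up to equality of
-- coefficients. So every series is accompanied, degree by degree, by a duplicate-free list of the
-- objects that it counts. These objects are bare lists of numbers, described by inductive
-- predicates whose constructors mirror the factors of the products; the proofs stored in `POD` and
-- `PE` enter only at the very end.

open import Defs
open import Algebra.Bundles using (CommutativeRing)
open import Data.Nat.Base using (ℕ)

-- Polynomial identities with integer coefficients in a commutative ring

module IntegerCoefficients {c ℓ} (R : CommutativeRing c ℓ) where
  open CommutativeRing R
  open import Algebra.Properties.Ring ring
    using (-0#≈0#; -‿involutive; -‿+-comm; -‿distribˡ-*; -‿distribʳ-*)
  open import Algebra.Properties.Semiring.Mult.TCOptimised semiring
    using () renaming (_×_ to _×′_; ×-homo-+ to ×′-homo-+; ×1-homo-* to ×′1-homo-*)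
  import Algebra.Solver.Ring as Solver
  import Algebra.Solver.Ring.AlmostCommutativeRing as ACR
  open import Data.Integer.Base as ℤ using (ℤ; +_; -[1+_]; _⊖_)
  import Data.Integer.Properties as ℤ
  open import Data.Maybe.Base using (Maybe; just; nothing)
  open import Data.Nat.Base as ℕ using (ℕ; zero; suc)
  open import Relation.Binary.PropositionalEquality.Core as ≡ using (_≡_)
  open import Relation.Binary.Reasoning.Setoid setoid
  open import Relation.Nullary.Decidable.Core using (yes; no)
  open import Algebra.Properties.CommutativeSemigroup +-commutativeSemigroup using (interchange)

  -- Identities are normalised over ℤ, where equality is decidable. With this version of the
  -- multiple, `⟦ + 1 ⟧ℤ` is `1#` itself and not `1# + 0#`, so `con (+ 1)` stands for the literal
  -- `1#`.
  ⟦_⟧ℤ : ℤ → Carrier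
  ⟦ + n ⟧ℤ      = n ×′ 1#
  ⟦ -[1+ n ] ⟧ℤ = - (suc n ×′ 1#)

  private
    ⟦-⟧ : ∀ i → ⟦ ℤ.- i ⟧ℤ ≈ - ⟦ i ⟧ℤ
    ⟦-⟧ (+ zero)   = sym -0#≈0#
    ⟦-⟧ (+ suc n)  = refl
    ⟦-⟧ -[1+ n ]   = sym (-‿involutive _)

    ⟦⊖⟧ : ∀ m n → ⟦ m ⊖ n ⟧ℤ ≈ m ×′ 1# - n ×′ 1#
    ⟦⊖⟧ m zero = sym (trans (+-congˡ -0#≈0#) (+-identityʳ _))
    ⟦⊖⟧ zero (suc n) = sym (+-identityˡ _)
    ⟦⊖⟧ (suc m) (suc n) = begin
      ⟦ suc m ⊖ suc n ⟧ℤ                      ≡⟨ ≡.cong ⟦_⟧ℤ (ℤ.[1+m]⊖[1+n]≡m⊖n m n) ⟩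
      ⟦ m ⊖ n ⟧ℤ                              ≈⟨ ⟦⊖⟧ m n ⟩
      m ×′ 1# - n ×′ 1#                       ≈⟨ +-identityˡ _ ⟨
      0# + (m ×′ 1# - n ×′ 1#)                ≈⟨ +-congʳ (-‿inverseʳ 1#) ⟨
      (1# - 1#) + (m ×′ 1# - n ×′ 1#)         ≈⟨ interchange _ _ _ _ ⟩
      (1# + m ×′ 1#) + (- 1# + - (n ×′ 1#))   ≈⟨ +-congˡ (-‿+-comm _ _) ⟩
      (1# + m ×′ 1#) - (1# + n ×′ 1#)         ≈⟨ +-cong (×′-homo-+ 1# 1 m) (-‿cong (×′-homo-+ 1# 1 n)) ⟨
      suc m ×′ 1# - suc n ×′ 1#               ∎

    ⟦+⟧ : ∀ i j → ⟦ i ℤ.+ j ⟧ℤ ≈ ⟦ i ⟧ℤ + ⟦ j ⟧ℤ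
    ⟦+⟧ (+ m)    (+ n)    = ×′-homo-+ 1# m n
    ⟦+⟧ (+ m)    -[1+ n ] = ⟦⊖⟧ m (suc n)
    ⟦+⟧ -[1+ m ] (+ n)    = trans (⟦⊖⟧ n (suc m)) (+-comm _ _)
    ⟦+⟧ -[1+ m ] -[1+ n ] = begin
      - (suc (suc (m ℕ.+ n)) ×′ 1#)       ≡⟨ ≡.cong (λ k → - (k ×′ 1#)) (≡.sym (ℕ.+-suc (suc m) n)) ⟩
      - ((suc m ℕ.+ suc n) ×′ 1#)         ≈⟨ -‿cong (×′-homo-+ 1# (suc m) (suc n)) ⟩
      - (suc m ×′ 1# + suc n ×′ 1#)       ≈⟨ -‿+-comm _ _ ⟨
      - (suc m ×′ 1#) + - (suc n ×′ 1#)   ∎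
      where import Data.Nat.Properties as ℕ

    ⟦pos*⟧ : ∀ m j → ⟦ + m ℤ.* j ⟧ℤ ≈ ⟦ + m ⟧ℤ * ⟦ j ⟧ℤ
    ⟦pos*⟧ m (+ n) = begin
      ⟦ + m ℤ.* + n ⟧ℤ       ≡⟨ ≡.cong ⟦_⟧ℤ (ℤ.pos-* m n) ⟨
      (m ℕ.* n) ×′ 1#        ≈⟨ ×′1-homo-* m n ⟩
      m ×′ 1# * n ×′ 1#      ∎
    ⟦pos*⟧ m j@(-[1+ n ]) = begin
      ⟦ + m ℤ.* j ⟧ℤ              ≡⟨ ≡.cong ⟦_⟧ℤ (ℤ.neg-distribʳ-* (+ m) (+ suc n)) ⟨
      ⟦ ℤ.- (+ m ℤ.* + suc n) ⟧ℤ  ≈⟨ ⟦-⟧ (+ m ℤ.* + suc n) ⟩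
      - ⟦ + m ℤ.* + suc n ⟧ℤ      ≈⟨ -‿cong (⟦pos*⟧ m (+ suc n)) ⟩
      - (⟦ + m ⟧ℤ * ⟦ + suc n ⟧ℤ) ≈⟨ -‿distribʳ-* _ _ ⟩
      ⟦ + m ⟧ℤ * ⟦ j ⟧ℤ           ∎

    ⟦*⟧ : ∀ i j → ⟦ i ℤ.* j ⟧ℤ ≈ ⟦ i ⟧ℤ * ⟦ j ⟧ℤ
    ⟦*⟧ (+ m) j = ⟦pos*⟧ m j
    ⟦*⟧ -[1+ m ] j = begin
      ⟦ -[1+ m ] ℤ.* j ⟧ℤ         ≡⟨ ≡.cong ⟦_⟧ℤ (ℤ.neg-distribˡ-* (+ suc m) j) ⟨
      ⟦ ℤ.- (+ suc m ℤ.* j) ⟧ℤ    ≈⟨ ⟦-⟧ (+ suc m ℤ.* j) ⟩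
      - ⟦ + suc m ℤ.* j ⟧ℤ        ≈⟨ -‿cong (⟦pos*⟧ (suc m) j) ⟩
      - (⟦ + suc m ⟧ℤ * ⟦ j ⟧ℤ)   ≈⟨ -‿distribˡ-* _ _ ⟩
      ⟦ -[1+ m ] ⟧ℤ * ⟦ j ⟧ℤ      ∎

    almostCommutativeRing : ACR.AlmostCommutativeRing c ℓ
    almostCommutativeRing = ACR.fromCommutativeRing R

    morphism : ℤ.+-*-rawRing ACR.-Raw-AlmostCommutative⟶ almostCommutativeRing
    morphism = record
      { ⟦_⟧    = ⟦_⟧ℤ
      ; +-homo = ⟦+⟧
      ; *-homo = ⟦*⟧
      ; -‿homo = ⟦-⟧
      ; 0-homo = refl
      ; 1-homo = refl
      }

    _≟′_ : ∀ i j → Maybe (⟦ i ⟧ℤ ≈ ⟦ j ⟧ℤ)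
    i ≟′ j with i ℤ.≟ j
    ... | yes i≡j = just (reflexive (≡.cong ⟦_⟧ℤ i≡j))
    ... | no  _   = nothing

  open Solver ℤ.+-*-rawRing almostCommutativeRing morphism _≟′_ public
    using (solve; _:=_; _:+_; _:*_; _:-_; :-_; con)

-- Finite q-series identities in a commutative ring

module QSeries {c ℓ} (R : CommutativeRing c ℓ) where
  open CommutativeRing R
  open IntegerCoefficients R
  open import Algebra.Properties.CommutativeSemiring.Exp commutativeSemiring
    using (_^_; ^-congˡ; ^-distrib-*; ^-homo-*)
  open import Data.Integer.Base using (+_)
  open import Data.Nat.Base as ℕ using (ℕ; zero; suc)
  open import Relation.Binary.Reasoning.Setoid setoid
  import Data.Nat.Properties as ℕ

  *-inverse-cancel : ∀ f {g h} → g * h ≈ 1# → f * h * g ≈ f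
  *-inverse-cancel f {g} {h} gh≈1 = begin
    f * h * g    ≈⟨ solve 3 (λ f g h → f :* h :* g := f :* (g :* h)) refl f g h ⟩
    f * (g * h)  ≈⟨ *-congˡ gh≈1 ⟩
    f * 1#       ≈⟨ *-identityʳ f ⟩
    f            ∎

  -- If `m` is the weight of a part, `h` allows it any number of times: either it does not occur, or
  -- one copy can be taken off.
  *-inverse-unfold : ∀ f m {h} → (1# - m) * h ≈ 1# → f * h ≈ f + m * (f * h)
  *-inverse-unfold f m {h} inv = begin
    f * h                          ≈⟨ solve 2 (λ m x → x := x :* (con (+ 1) :- m) :+ m :* x) refl m (f * h) ⟩
    f * h * (1# - m) + m * (f * h) ≈⟨ +-congʳ (*-inverse-cancel f inv) ⟩
    f + m * (f * h)                ∎

  ∑< : ℕ → (ℕ → Carrier) → Carrier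
  ∑< zero    f = 0#
  ∑< (suc n) f = ∑< n f + f n

  ∑<-cong : ∀ n {f g} → (∀ {i} → i ℕ.< n → f i ≈ g i) → ∑< n f ≈ ∑< n g
  ∑<-cong zero    f≈g = refl
  ∑<-cong (suc n) f≈g = +-cong (∑<-cong n (λ i<n → f≈g (ℕ.m<n⇒m<1+n i<n))) (f≈g ℕ.≤-refl)

  ∑<-distribʳ : ∀ n f x → ∑< n f * x ≈ ∑< n (λ i → f i * x)
  ∑<-distribʳ zero    f x = zeroˡ x
  ∑<-distribʳ (suc n) f x = trans (distribʳ x _ _) (+-congʳ (∑<-distribʳ n f x))

  ∑<-head : ∀ n f → ∑< (suc n) f ≈ f 0 + ∑< n (λ i → f (suc i))
  ∑<-head zero    f = +-comm _ _
  ∑<-head (suc n) f = trans (+-congʳ (∑<-head n f)) (+-assoc _ _ _)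

  poch : Carrier → Carrier → ℕ → Carrier
  poch a b zero    = 1#
  poch a b (suc k) = poch a b k * (1# - a * b ^ k)

  poch-congˡ : ∀ {a a′} b k → a ≈ a′ → poch a b k ≈ poch a′ b k
  poch-congˡ b zero    a≈a′ = refl
  poch-congˡ b (suc k) a≈a′ = *-cong (poch-congˡ b k a≈a′) (+-congˡ (-‿cong (*-congʳ a≈a′)))

  poch-0 : ∀ {a} b k → a ≈ 0# → poch a b k ≈ 1#
  poch-0 b zero    a≈0 = refl
  poch-0 {a} b (suc k) a≈0 = begin
    poch a b k * (1# - a * b ^ k)  ≈⟨ *-cong (poch-0 b k a≈0) (+-congˡ (-‿cong (*-congʳ a≈0))) ⟩
    1# * (1# - 0# * b ^ k)         ≈⟨ solve 1 (λ x → con (+ 1) :* (con (+ 1) :- con (+ 0) :* x) := con (+ 1)) refl (b ^ k) ⟩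
    1#                             ∎

  poch-head : ∀ a b k → poch a b (suc k) ≈ (1# - a) * poch (a * b) b k
  poch-head a b zero    = solve 1 (λ x → con (+ 1) :* (con (+ 1) :- x :* con (+ 1)) := (con (+ 1) :- x) :* con (+ 1)) refl a
  poch-head a b (suc k) = begin
    poch a b (suc k) * (1# - a * (b * b ^ k))             ≈⟨ *-cong (poch-head a b k) (+-congˡ (-‿cong (sym (*-assoc a b (b ^ k))))) ⟩
    (1# - a) * poch (a * b) b k * (1# - a * b * b ^ k)    ≈⟨ *-assoc _ _ _ ⟩
    (1# - a) * (poch (a * b) b k * (1# - a * b * b ^ k))  ∎

  -- All factors from `1 - a bᵏ` on are 1, so a finite product can replace the infinite one.
  poch-stable : ∀ a b {k} m → a * b ^ k ≈ 0# → poch a b (m ℕ.+ k) ≈ poch a b k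
  poch-stable a b zero abᵏ≈0 = refl
  poch-stable a b {k} (suc m) abᵏ≈0 = begin
    poch a b (m ℕ.+ k) * (1# - a * b ^ (m ℕ.+ k))  ≈⟨ *-cong (poch-stable a b m abᵏ≈0) (+-congˡ (-‿cong abᵐ⁺ᵏ≈0)) ⟩
    poch a b k * (1# - 0#)                         ≈⟨ solve 1 (λ x → x :* (con (+ 1) :- con (+ 0)) := x) refl (poch a b k) ⟩
    poch a b k                                     ∎
    where
    abᵐ⁺ᵏ≈0 : a * b ^ (m ℕ.+ k) ≈ 0#
    abᵐ⁺ᵏ≈0 = begin
      a * b ^ (m ℕ.+ k)      ≈⟨ *-congˡ (^-homo-* b m k) ⟩
      a * (b ^ m * b ^ k)    ≈⟨ solve 3 (λ a x y → a :* (x :* y) := x :* (a :* y)) refl a (b ^ m) (b ^ k) ⟩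
      b ^ m * (a * b ^ k)    ≈⟨ *-congˡ abᵏ≈0 ⟩
      b ^ m * 0#             ≈⟨ zeroʳ _ ⟩
      0#                     ∎

  -- Deciding whether a part of weight `q bᵏ` occurs contributes the factor `1 + q bᵏ`; hence the
  -- argument `- q`.
  poch-unique : ∀ q b f (g x : ℕ → Carrier) → g 0 ≈ f → (∀ k → x k ≈ q * b ^ k) →
    (∀ k → g (suc k) ≈ g k + x k * g k) → ∀ k → g k ≈ f * poch (- q) b k
  poch-unique q b f g x g₀≈f x≈ g-step zero    = trans g₀≈f (sym (*-identityʳ f))
  poch-unique q b f g x g₀≈f x≈ g-step (suc k) = begin
    g (suc k)                                    ≈⟨ g-step k ⟩
    g k + x k * g k                              ≈⟨ +-cong ih (*-cong (x≈ k) ih) ⟩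
    f * poch (- q) b k + q * b ^ k * (f * poch (- q) b k)
      ≈⟨ solve 4 (λ q y f p → f :* p :+ q :* y :* (f :* p) := f :* (p :* (con (+ 1) :- (:- q) :* y))) refl q (b ^ k) f (poch (- q) b k) ⟩
    f * poch (- q) b (suc k)                     ∎
    where ih = poch-unique q b f g x g₀≈f x≈ g-step k

  -- D and T count partitions into distinct odd parts, T with a factor z if the largest part 2 k + 3
  -- is isolated; increasing the largest part by 2 shows that these are counted by Q (D - 1).
  isolated-parts : ∀ z Q (D T x : ℕ → Carrier) → D 0 ≈ 1# → T 0 ≈ 1# + x 0 → (∀ k → x (suc k) ≈ x k * Q) →
    (∀ k → D (suc k) ≈ D k + x k * D k) → (∀ k → T (suc k) ≈ T k + (z * x (suc k) * D k + x (suc k) * x k * D k)) →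
    ∀ k → T k + (z - 1#) * Q ≈ D (suc k) + (z - 1#) * Q * D k
  isolated-parts z Q D T x D₀≈1 T₀≈ x-step D-step T-step zero = begin
    T 0 + (z - 1#) * Q                        ≈⟨ +-congʳ T₀≈ ⟩
    1# + x 0 + (z - 1#) * Q
      ≈⟨ solve 3 (λ z q x → con (+ 1) :+ x :+ (z :- con (+ 1)) :* q
           := con (+ 1) :+ x :* con (+ 1) :+ (z :- con (+ 1)) :* q :* con (+ 1)) refl z Q (x 0) ⟩
    1# + x 0 * 1# + (z - 1#) * Q * 1#         ≈⟨ +-cong (+-cong D₀≈1 (*-congˡ D₀≈1)) (*-congˡ D₀≈1) ⟨
    D 0 + x 0 * D 0 + (z - 1#) * Q * D 0      ≈⟨ +-congʳ (D-step 0) ⟨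
    D 1 + (z - 1#) * Q * D 0                  ∎
  isolated-parts z Q D T x D₀≈1 T₀≈ x-step D-step T-step (suc k) = begin
    T (suc k) + (z - 1#) * Q
      ≈⟨ +-congʳ (T-step k) ⟩
    T k + (z * x (suc k) * D k + x (suc k) * x k * D k) + (z - 1#) * Q
      ≈⟨ solve 3 (λ t u v → t :+ u :+ v := t :+ v :+ u) refl (T k) _ _ ⟩
    T k + (z - 1#) * Q + (z * x (suc k) * D k + x (suc k) * x k * D k)
      ≈⟨ +-congʳ (isolated-parts z Q D T x D₀≈1 T₀≈ x-step D-step T-step k) ⟩
    D (suc k) + (z - 1#) * Q * D k + (z * x (suc k) * D k + x (suc k) * x k * D k)
      -- The new terms amount to `x′ (d + x d)`, which completes the next `D`, and an excess
      -- `(z - 1) x′ d` for the isolated part. As `x′ = x Q`, the excess carries `(z - 1) Q d` to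
      -- its next value.
      ≈⟨ solve 6 (λ z q d d′ x x′ →
           d′ :+ (z :- con (+ 1)) :* q :* d :+ (z :* x′ :* d :+ x′ :* x :* d)
           := d′ :+ x′ :* (d :+ x :* d) :+ ((z :- con (+ 1)) :* (q :* d) :+ (z :- con (+ 1)) :* x′ :* d))
           refl z Q (D k) (D (suc k)) (x k) (x (suc k)) ⟩
    D (suc k) + x (suc k) * (D k + x k * D k) + ((z - 1#) * (Q * D k) + (z - 1#) * x (suc k) * D k)
      ≈⟨ +-cong (+-congˡ (*-congˡ (sym (D-step k)))) (+-congˡ (*-congʳ (*-congˡ (x-step k)))) ⟩
    D (suc k) + x (suc k) * D (suc k) + ((z - 1#) * (Q * D k) + (z - 1#) * (x k * Q) * D k)
      ≈⟨ +-cong (sym (D-step (suc k))) (solve 4 (λ z q d x →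
           (z :- con (+ 1)) :* (q :* d) :+ (z :- con (+ 1)) :* (x :* q) :* d
           := (z :- con (+ 1)) :* q :* (d :+ x :* d)) refl z Q (D k) (x k)) ⟩
    D (suc (suc k)) + (z - 1#) * Q * (D k + x k * D k)
      ≈⟨ +-congˡ (*-congˡ (D-step k)) ⟨
    D (suc (suc k)) + (z - 1#) * Q * D (suc k)  ∎

  -- The summand (z - 1) Q by which E differs from 1 + C is exactly what the isolated largest parts
  -- of T contribute, up to their own exception (z - 1) Q.
  weighted-total : ∀ {z Q T C O D D′ x p E X Y W i} → T + (z - 1#) * Q ≈ D′ + (z - 1#) * Q * D → D′ ≈ D + x * D → x ≈ 0# →
    D′ ≈ 1# * p → O ≈ C * p → E ≈ 1# - Q + z * Q + C → E * (X * Y) ≈ W → X * Y * i ≈ 1# →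
    T + O + (z - 1#) * Q ≈ p * W * i
  weighted-total {z} {Q} {T} {C} {O} {D} {D′} {x} {p} {E} {X} {Y} {W} {i} T≈ D′≈ x≈0 D′≈p O≈ E≈ E*≈ inv = begin
    T + O + (z - 1#) * Q                      ≈⟨ solve 3 (λ t o u → t :+ o :+ u := t :+ u :+ o) refl T O ((z - 1#) * Q) ⟩
    T + (z - 1#) * Q + O                      ≈⟨ +-cong T≈ O≈ ⟩
    D′ + (z - 1#) * Q * D + C * p             ≈⟨ +-congʳ (+-cong D′≈1p (*-congˡ D≈p)) ⟩
    p + (z - 1#) * Q * p + C * p              ≈⟨ solve 4 (λ z q c p → p :+ (z :- con (+ 1)) :* q :* p :+ c :* p
                                                   := p :* (con (+ 1) :- q :+ z :* q :+ c)) refl z Q C p ⟩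
    p * (1# - Q + z * Q + C)                  ≈⟨ *-congˡ E≈ ⟨
    p * E                                     ≈⟨ *-inverse-cancel (p * E) inv′ ⟨
    p * E * (X * Y) * i                       ≈⟨ *-congʳ (trans (*-assoc p E (X * Y)) (*-congˡ E*≈)) ⟩
    p * W * i                                 ∎
    where
    D′≈1p : D′ ≈ p
    D′≈1p = trans D′≈p (*-identityˡ p)
    -- The last part allowed has weight `x ≈ 0`, so `D` and `D′` coincide.
    D≈p : D ≈ p
    D≈p = begin
      D           ≈⟨ solve 2 (λ d z → d := d :+ con (+ 0) :* d) refl D z ⟩
      D + 0# * D  ≈⟨ +-congˡ (*-congʳ x≈0) ⟨
      D + x * D   ≈⟨ D′≈ ⟨
      D′          ≈⟨ D′≈1p ⟩
      p           ∎
    inv′ : i * (X * Y) ≈ 1#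
    inv′ = trans (*-comm i (X * Y)) inv

  -- The q-binomial theorem: cⱼ = (a ; q)ⱼ / (q ; q)ⱼ up to a constant factor, and
  -- S y = Σⱼ cⱼ yʲ satisfies (1 - y) S y = (1 - a y) S (y q).
  module QBinomial (q a : Carrier) (c : ℕ → Carrier)
    (c-step : ∀ j → c (suc j) * (1# - q ^ suc j) ≈ c j * (1# - a * q ^ j)) where

    S : ℕ → Carrier → Carrier
    S J y = ∑< J (λ j → c j * y ^ j)

    -- The functional equation for a partial sum: comparing coefficients of `y` telescopes, and only
    -- the term at `J` is left over. It disappears once `y ^ J` vanishes.
    S-step′ : ∀ J y → (1# - y) * S J y + c J * (1# - q ^ J) * y ^ J ≈ (1# - a * y) * S J (y * q)
    S-step′ zero y = solve 3 (λ a y c → (con (+ 1) :- y) :* con (+ 0) :+ c :* (con (+ 1) :- con (+ 1)) :* con (+ 1)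
                                := (con (+ 1) :- a :* y) :* con (+ 0)) refl a y (c 0)
    S-step′ (suc J) y = begin
      (1# - y) * (S J y + c J * y ^ J) + c (suc J) * (1# - q ^ suc J) * (y * y ^ J)
        ≈⟨ +-congˡ (*-congʳ (c-step J)) ⟩
      (1# - y) * (S J y + c J * y ^ J) + c J * (1# - a * q ^ J) * (y * y ^ J)
        ≈⟨ solve 6 (λ a y s c q y′ →
              (con (+ 1) :- y) :* (s :+ c :* y′) :+ c :* (con (+ 1) :- a :* q) :* (y :* y′)
              := ((con (+ 1) :- y) :* s :+ c :* (con (+ 1) :- q) :* y′) :+ (con (+ 1) :- a :* y) :* (c :* (y′ :* q)))
              refl a y (S J y) (c J) (q ^ J) (y ^ J) ⟩
      ((1# - y) * S J y + c J * (1# - q ^ J) * y ^ J) + (1# - a * y) * (c J * (y ^ J * q ^ J))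
        ≈⟨ +-cong (S-step′ J y) (*-congˡ (*-congˡ (sym (^-distrib-* y q J)))) ⟩
      (1# - a * y) * S J (y * q) + (1# - a * y) * (c J * (y * q) ^ J)
        ≈⟨ distribˡ _ _ _ ⟨
      (1# - a * y) * S (suc J) (y * q)  ∎

    module _ (J : ℕ) where

      S-step : ∀ y → y ^ J ≈ 0# → (1# - y) * S J y ≈ (1# - a * y) * S J (y * q)
      S-step y yᴶ≈0 = begin
        (1# - y) * S J y                                    ≈⟨ +-identityʳ _ ⟨
        (1# - y) * S J y + 0#                               ≈⟨ +-congˡ (zeroʳ _) ⟨
        (1# - y) * S J y + c J * (1# - q ^ J) * 0#          ≈⟨ +-congˡ (*-congˡ yᴶ≈0) ⟨
        (1# - y) * S J y + c J * (1# - q ^ J) * y ^ J       ≈⟨ S-step′ J y ⟩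
        (1# - a * y) * S J (y * q)                          ∎

      S-iterate : ∀ k y → y ^ J ≈ 0# → poch y q k * S J y ≈ poch (a * y) q k * S J (y * q ^ k)
      S-iterate zero y yᴶ≈0 = *-congˡ (S-cong (sym (*-identityʳ y)))
        where
        S-cong : ∀ {x y} → x ≈ y → S J x ≈ S J y
        S-cong x≈y = ∑<-cong J (λ {j} _ → *-congˡ (^-congˡ j x≈y))
      S-iterate (suc k) y yᴶ≈0 = begin
        poch y q k * (1# - y * q ^ k) * S J y
          ≈⟨ solve 3 (λ x y z → x :* y :* z := y :* (x :* z)) refl _ _ _ ⟩
        (1# - y * q ^ k) * (poch y q k * S J y)
          ≈⟨ *-congˡ (S-iterate k y yᴶ≈0) ⟩
        (1# - y * q ^ k) * (poch (a * y) q k * S J (y * q ^ k))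
          ≈⟨ solve 3 (λ x y z → x :* (y :* z) := y :* (x :* z)) refl _ _ _ ⟩
        poch (a * y) q k * ((1# - y * q ^ k) * S J (y * q ^ k))
          ≈⟨ *-congˡ (S-step (y * q ^ k) yqᴶ≈0) ⟩
        poch (a * y) q k * ((1# - a * (y * q ^ k)) * S J (y * q ^ k * q))
          ≈⟨ *-assoc _ _ _ ⟨
        poch (a * y) q k * (1# - a * (y * q ^ k)) * S J (y * q ^ k * q)
          ≈⟨ *-cong (*-congˡ (+-congˡ (-‿cong (sym (*-assoc _ _ _))))) (∑<-cong J (λ {j} _ → *-congˡ (^-congˡ j eq))) ⟩
        poch (a * y) q k * (1# - a * y * q ^ k) * S J (y * (q * q ^ k))  ∎
        where
        eq = solve 3 (λ x y z → x :* y :* z := x :* (z :* y)) refl y (q ^ k) q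
        yqᴶ≈0 : (y * q ^ k) ^ J ≈ 0#
        yqᴶ≈0 = begin
          (y * q ^ k) ^ J      ≈⟨ ^-distrib-* y (q ^ k) J ⟩
          y ^ J * (q ^ k) ^ J  ≈⟨ *-congʳ yᴶ≈0 ⟩
          0# * (q ^ k) ^ J     ≈⟨ zeroˡ _ ⟩
          0#                   ∎

    S-0 : ∀ J {y} → y ≈ 0# → S (suc J) y ≈ c 0
    S-0 J {y} y≈0 = begin
      S (suc J) y                                             ≈⟨ ∑<-head J _ ⟩
      c 0 * 1# + ∑< J (λ j → c (suc j) * (y * y ^ j))         ≈⟨ +-cong (*-identityʳ _) (∑<-cong J (λ {j} _ → trans (*-congˡ (*-congʳ y≈0)) (trans (*-congˡ (zeroˡ _)) (trans (zeroʳ _) (sym (zeroˡ 0#)))))) ⟩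
      -- With the vanishing terms written as `0# * 0#`, distributivity pulls a zero out of the sum.
      c 0 + ∑< J (λ j → 0# * 0#)                              ≈⟨ +-congˡ (∑<-distribʳ J _ _) ⟨
      c 0 + ∑< J (λ j → 0#) * 0#                              ≈⟨ +-congˡ (zeroʳ _) ⟩
      c 0 + 0#                                                ≈⟨ +-identityʳ _ ⟩
      c 0                                                     ∎

    -- Iterate the functional equation until the argument `y qᵏ` is 0, where only the constant term
    -- survives. Nilpotency of `y` makes the partial sum complete.
    q-binomial : ∀ J y k → y ^ suc J ≈ 0# → y * q ^ k ≈ 0# →
      poch y q k * S (suc J) y ≈ poch (a * y) q k * c 0
    q-binomial J y k yᴶ≈0 yqᵏ≈0 = trans (S-iterate (suc J) k y yᴶ≈0) (*-congˡ (S-0 J yqᵏ≈0))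

  -- Here Q is nilpotent, so all sums and products are finite.  V j counts the partitions with parts
  -- in [2 , j], M the ones-free ones by z to the largest part, and P j those with exactly j ones.
  module Crank (Q z z′ : Carrier) (zz′≈1 : z * z′ ≈ 1#) (K : ℕ) (Qᴷ⁺¹≈0 : Q ^ suc K ≈ 0#)
    (V M P : ℕ → Carrier)
    (V-1 : V 1 ≈ 1#)
    (V-step : ∀ j → V (suc (suc j)) * (1# - Q ^ suc (suc j)) ≈ V (suc j))
    (M-1 : M 1 ≈ 0#)
    (M-step : ∀ j → M (suc (suc j)) ≈ M (suc j) + (z * Q) ^ suc (suc j) * V (suc (suc j)))
    (P-step : ∀ {j} → j ℕ.< K → P (suc j) * poch (z * Q) Q K ≈ (z′ * Q) ^ suc j * V (suc j) * poch (z * Q) Q (suc j))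
    where

    -- This is (1 - Q) / (Q; Q)ⱼ. For j ≥ 1 the numerator cancels the factor for parts equal to 1
    -- and leaves `V j`; at j = 0 it survives.
    c₁ : ℕ → Carrier
    c₁ zero    = 1# - Q
    c₁ (suc j) = V (suc j)

    c₁-step : ∀ j → c₁ (suc j) * (1# - Q ^ suc j) ≈ c₁ j
    c₁-step zero = begin
      V 1 * (1# - Q * 1#)  ≈⟨ *-congʳ V-1 ⟩
      1# * (1# - Q * 1#)   ≈⟨ solve 1 (λ q → con (+ 1) :* (con (+ 1) :- q :* con (+ 1)) := con (+ 1) :- q) refl Q ⟩
      1# - Q               ∎
    c₁-step (suc j) = V-step j

    c₂ : ℕ → Carrier
    c₂ j = c₁ j * poch (z * Q) Q j

    -- The case a = 0, which at y = z Q expands (1 - Q) / (z Q; Q)∞ in powers of z Q.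
    module Euler = QBinomial Q 0# c₁
      (λ j → trans (c₁-step j) (solve 2 (λ c q → c := c :* (con (+ 1) :- con (+ 0) :* q)) refl (c₁ j) (Q ^ j)))
    -- The case a = z Q, to be taken at y = z⁻¹ Q, where z cancels in a y = Q².
    module Cauchy = QBinomial Q (z * Q) c₂
      (λ j → trans (solve 3 (λ c p q → c :* p :* q := c :* q :* p) refl (c₁ (suc j)) _ _)
             (trans (*-congʳ (c₁-step j)) (sym (*-assoc _ _ _))))

    -- The terms at 0 and 1 are 1 - Q and z Q; from 2 on, the exponent of z is the largest part of a
    -- partition without ones.
    M≈ : ∀ k → Euler.S (suc (suc k)) (z * Q) ≈ 1# - Q + z * Q + M (suc k)
    M≈ zero = begin
      0# + (1# - Q) * 1# + V 1 * (z * Q * 1#)   ≈⟨ +-cong refl (*-congʳ V-1) ⟩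
      0# + (1# - Q) * 1# + 1# * (z * Q * 1#)
        ≈⟨ solve 2 (λ q z → con (+ 0) :+ (con (+ 1) :- q) :* con (+ 1) :+ con (+ 1) :* (z :* q :* con (+ 1))
                            := con (+ 1) :- q :+ z :* q :+ con (+ 0)) refl Q z ⟩
      1# - Q + z * Q + 0#                       ≈⟨ +-congˡ M-1 ⟨
      1# - Q + z * Q + M 1                      ∎
    M≈ (suc k) = begin
      Euler.S (suc (suc k)) (z * Q) + V (suc (suc k)) * (z * Q) ^ suc (suc k)   ≈⟨ +-cong (M≈ k) (*-comm _ _) ⟩
      1# - Q + z * Q + M (suc k) + (z * Q) ^ suc (suc k) * V (suc (suc k))      ≈⟨ +-assoc _ _ _ ⟩
      1# - Q + z * Q + (M (suc k) + (z * Q) ^ suc (suc k) * V (suc (suc k)))    ≈⟨ +-congˡ (M-step k) ⟨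
      1# - Q + z * Q + M (suc (suc k))                                          ∎

    private
      nilpotent : ∀ x → (x * Q) ^ suc K ≈ 0#
      nilpotent x = trans (^-distrib-* x Q (suc K)) (trans (*-congˡ Qᴷ⁺¹≈0) (zeroʳ _))

      vanish : ∀ x → x * Q * Q ^ K ≈ 0#
      vanish x = trans (*-assoc _ _ _) (trans (*-congˡ Qᴷ⁺¹≈0) (zeroʳ x))

      reciprocal : z * Q * (z′ * Q) ≈ Q * Q
      reciprocal = begin
        z * Q * (z′ * Q)    ≈⟨ solve 3 (λ q z z′ → z :* q :* (z′ :* q) := z :* z′ :* (q :* q)) refl Q z z′ ⟩
        z * z′ * (Q * Q)    ≈⟨ *-congʳ zz′≈1 ⟩
        1# * (Q * Q)        ≈⟨ *-identityˡ _ ⟩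
        Q * Q               ∎

    euler : Euler.S (suc K) (z * Q) * poch (z * Q) Q K ≈ 1# - Q
    euler = begin
      Euler.S (suc K) (z * Q) * poch (z * Q) Q K   ≈⟨ *-comm _ _ ⟩
      poch (z * Q) Q K * Euler.S (suc K) (z * Q)   ≈⟨ Euler.q-binomial K (z * Q) K (nilpotent z) (vanish z) ⟩
      poch (0# * (z * Q)) Q K * (1# - Q)           ≈⟨ *-congʳ (poch-0 Q K (zeroˡ _)) ⟩
      1# * (1# - Q)                                ≈⟨ *-identityˡ _ ⟩
      1# - Q                                       ∎

    module _ where
      private
        X Y : Carrier
        X = poch (z * Q) Q K
        Y = poch (z′ * Q) Q K

      -- Multiplication by (z Q; Q)∞ turns `P j` into the term at j of the Cauchy sum, and by
      -- `euler` it turns the whole Euler sum into 1 - Q, which is the term at 0.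
      cauchy : (Euler.S (suc K) (z * Q) + ∑< K (λ j → P (suc j))) * X ≈ Cauchy.S (suc K) (z′ * Q)
      cauchy = begin
        (Euler.S (suc K) (z * Q) + ∑< K (λ j → P (suc j))) * X        ≈⟨ distribʳ _ _ _ ⟩
        Euler.S (suc K) (z * Q) * X + ∑< K (λ j → P (suc j)) * X      ≈⟨ +-cong euler (∑<-distribʳ K _ X) ⟩
        1# - Q + ∑< K (λ j → P (suc j) * X)                           ≈⟨ +-cong (solve 1 (λ q → q := q :* con (+ 1) :* con (+ 1)) refl (1# - Q)) (∑<-cong K (λ {j} j<K → trans (P-step j<K) (eq j))) ⟩
        c₂ 0 * 1# + ∑< K (λ j → c₂ (suc j) * (z′ * Q) ^ suc j)        ≈⟨ ∑<-head K _ ⟨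
        Cauchy.S (suc K) (z′ * Q)                                     ∎
        where
        eq : ∀ j → (z′ * Q) ^ suc j * V (suc j) * poch (z * Q) Q (suc j) ≈ c₂ (suc j) * (z′ * Q) ^ suc j
        eq j = trans (*-assoc _ _ _) (*-comm _ _)

      crank-identity : (Euler.S (suc K) (z * Q) + ∑< K (λ j → P (suc j))) * (X * Y) ≈ poch Q Q K
      crank-identity = begin
        (Euler.S (suc K) (z * Q) + ∑< K (λ j → P (suc j))) * (X * Y)  ≈⟨ *-assoc _ _ _ ⟨
        (Euler.S (suc K) (z * Q) + ∑< K (λ j → P (suc j))) * X * Y    ≈⟨ *-congʳ cauchy ⟩
        Cauchy.S (suc K) (z′ * Q) * Y                                 ≈⟨ *-comm _ _ ⟩
        Y * Cauchy.S (suc K) (z′ * Q)                                 ≈⟨ Cauchy.q-binomial K (z′ * Q) K (nilpotent z′) (vanish z′) ⟩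
        poch (z * Q * (z′ * Q)) Q K * c₂ 0                            ≈⟨ *-congʳ (poch-congˡ Q K reciprocal) ⟩
        poch (Q * Q) Q K * ((1# - Q) * 1#)                            ≈⟨ solve 2 (λ x y → x :* (y :* con (+ 1)) := y :* x) refl _ _ ⟩
        -- The constant `c₂ 0` supplies the factor that (Q²; Q)∞ lacks to be (Q; Q)∞.
        (1# - Q) * poch (Q * Q) Q K                                   ≈⟨ poch-head Q Q K ⟨
        poch Q Q (suc K)                                              ≈⟨ poch-stable Q Q {K} 1 Qᴷ⁺¹≈0 ⟩
        poch Q Q K                                                    ∎

-- The ring of Laurent polynomials, with equality of coefficients

module LaurentPolynomials where
  open import Data.Bool.Base using (if_then_else_; true; false)
  open import Data.Integer.Base hiding (+_)
  open import Data.Integer.Properties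
  open import Data.Integer.Tactic.RingSolver using (solve-∀)
  open import Data.List.Base using ([]; _∷_; map)
  open import Data.Product.Base using (_,_)
  open import Level using (0ℓ)
  open import Relation.Binary.PropositionalEquality
  open import Relation.Nullary.Decidable using (does; yes; no; dec-true; dec-false)
  open ≡-Reasoning

  infix 4 _≋_

  -- A record rather than a bare function type, so that `p` and `r` can be recovered from the type
  -- of a proof.
  record _≋_ (p r : Laurent) : Set where
    constructor mk≋
    field coeff-≡ : ∀ m → coeff m p ≡ coeff m r
  open _≋_ public

  private
    δ : ℤ → ℤ → ℤ → ℤ
    δ e m c = if does (e ≟ m) then c else 0ℤ

    δ-yes : ∀ {e m} c → e ≡ m → δ e m c ≡ c
    δ-yes {e} {m} c e≡m rewrite dec-true (e ≟ m) e≡m = refl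

    δ-no : ∀ {e m} c → e ≢ m → δ e m c ≡ 0ℤ
    δ-no {e} {m} c e≢m rewrite dec-false (e ≟ m) e≢m = refl

    δ-* : ∀ e f m c d → δ (e + f) m (c * d) ≡ c * δ f (m - e) d
    δ-* e f m c d with f ≟ m - e
    ... | yes f≡m-e = δ-yes (c * d) (trans (cong (e +_) f≡m-e) (lemma e m))
      where
      lemma : ∀ e m → e + (m - e) ≡ m
      lemma = solve-∀
    ... | no f≢m-e = trans (δ-no {e + f} {m} (c * d) (λ e+f≡m → f≢m-e (trans (lemma e f) (cong (_- e) e+f≡m)))) (sym (*-zeroʳ c))
      where
      lemma : ∀ e f → f ≡ e + f - e
      lemma = solve-∀

    coeff-map-* : ∀ m c e r → coeff m (map ((c , e) *ᴹ_) r) ≡ c * coeff (m - e) r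
    coeff-map-* m c e []            = sym (*-zeroʳ c)
    coeff-map-* m c e ((d , f) ∷ r) = begin
      δ (e + f) m (c * d) + coeff m (map ((c , e) *ᴹ_) r)  ≡⟨ cong₂ _+_ (δ-* e f m c d) (coeff-map-* m c e r) ⟩
      c * δ f (m - e) d + c * coeff (m - e) r              ≡⟨ *-distribˡ-+ c _ _ ⟨
      c * (δ f (m - e) d + coeff (m - e) r)                ∎

  coeff-+ : ∀ m p r → coeff m (p +ᴸ r) ≡ coeff m p + coeff m r
  coeff-+ m []            r = sym (+-identityˡ _)
  coeff-+ m ((c , e) ∷ p) r = trans (cong (δ e m c +_) (coeff-+ m p r)) (sym (+-assoc (δ e m c) (coeff m p) (coeff m r)))

  coeff-neg : ∀ m p → coeff m (-ᴸ p) ≡ - coeff m p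
  coeff-neg m []            = refl
  coeff-neg m ((c , e) ∷ p) = trans (cong₂ _+_ (δ-neg (does (e ≟ m))) (coeff-neg m p)) (sym (neg-distrib-+ (δ e m c) (coeff m p)))
    where
    δ-neg : ∀ b → (if b then - c else 0ℤ) ≡ - (if b then c else 0ℤ)
    δ-neg false = refl
    δ-neg true  = refl

  private
    coeff-∷-* : ∀ m c e p r → coeff m (((c , e) ∷ p) *ᴸ r) ≡ c * coeff (m - e) r + coeff m (p *ᴸ r)
    coeff-∷-* m c e p r = trans (coeff-+ m (map ((c , e) *ᴹ_) r) _) (cong (_+ _) (coeff-map-* m c e r))

    coeff-*-[] : ∀ m p → coeff m (p *ᴸ []) ≡ 0ℤ
    coeff-*-[] m []      = refl
    coeff-*-[] m (x ∷ p) = coeff-*-[] m p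

    -- Multiplication recurses on its first factor, so expanding along the second takes an induction
    -- of its own. Together with `coeff-∷-*` it yields commutativity.
    coeff-*-∷ : ∀ m d f p r → coeff m (p *ᴸ ((d , f) ∷ r)) ≡ d * coeff (m - f) p + coeff m (p *ᴸ r)
    coeff-*-∷ m d f []            r = sym (trans (+-identityʳ _) (*-zeroʳ d))
    coeff-*-∷ m d f ((c , e) ∷ p) r = begin
      coeff m (((c , e) ∷ p) *ᴸ ((d , f) ∷ r))
        ≡⟨ coeff-∷-* m c e p ((d , f) ∷ r) ⟩
      c * (δ f (m - e) d + coeff (m - e) r) + coeff m (p *ᴸ ((d , f) ∷ r))
        ≡⟨ cong₂ _+_ (*-distribˡ-+ c _ _) (coeff-*-∷ m d f p r) ⟩
      c * δ f (m - e) d + c * coeff (m - e) r + (d * coeff (m - f) p + coeff m (p *ᴸ r))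
        ≡⟨ cong (λ x → x + _ + _) swap ⟩
      d * δ e (m - f) c + c * coeff (m - e) r + (d * coeff (m - f) p + coeff m (p *ᴸ r))
        ≡⟨ rearrange d _ _ _ _ ⟩
      d * (δ e (m - f) c + coeff (m - f) p) + (c * coeff (m - e) r + coeff m (p *ᴸ r))
        ≡⟨ cong (d * coeff (m - f) ((c , e) ∷ p) +_) (coeff-∷-* m c e p r) ⟨
      d * coeff (m - f) ((c , e) ∷ p) + coeff m (((c , e) ∷ p) *ᴸ r)  ∎
      where
      swap : c * δ f (m - e) d ≡ d * δ e (m - f) c
      swap = begin
        c * δ f (m - e) d    ≡⟨ δ-* e f m c d ⟨
        δ (e + f) m (c * d)  ≡⟨ cong₂ (λ x y → δ x m y) (+-comm e f) (*-comm c d) ⟩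
        δ (f + e) m (d * c)  ≡⟨ δ-* f e m d c ⟩
        d * δ e (m - f) c    ∎
      rearrange : ∀ d x y u v → d * x + y + (d * u + v) ≡ d * (x + u) + (y + v)
      rearrange = solve-∀

    *ᴸ-comm : ∀ p r → p *ᴸ r ≋ r *ᴸ p
    *ᴸ-comm p r = mk≋ λ m → go m p
      where
      go : ∀ m p → coeff m (p *ᴸ r) ≡ coeff m (r *ᴸ p)
      go m []            = sym (coeff-*-[] m r)
      go m ((c , e) ∷ p) = begin
        coeff m (((c , e) ∷ p) *ᴸ r)              ≡⟨ coeff-∷-* m c e p r ⟩
        c * coeff (m - e) r + coeff m (p *ᴸ r)    ≡⟨ cong (c * coeff (m - e) r +_) (go m p) ⟩
        c * coeff (m - e) r + coeff m (r *ᴸ p)    ≡⟨ coeff-*-∷ m c e r p ⟨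
        coeff m (r *ᴸ ((c , e) ∷ p))              ∎

    *ᴸ-congˡ : ∀ p {r s} → r ≋ s → p *ᴸ r ≋ p *ᴸ s
    *ᴸ-congˡ p {r} {s} (mk≋ r≋s) = mk≋ λ m → go m p
      where
      go : ∀ m p → coeff m (p *ᴸ r) ≡ coeff m (p *ᴸ s)
      go m []            = refl
      go m ((c , e) ∷ p) = begin
        coeff m (((c , e) ∷ p) *ᴸ r)              ≡⟨ coeff-∷-* m c e p r ⟩
        c * coeff (m - e) r + coeff m (p *ᴸ r)    ≡⟨ cong₂ (λ x y → c * x + y) (r≋s (m - e)) (go m p) ⟩
        c * coeff (m - e) s + coeff m (p *ᴸ s)    ≡⟨ coeff-∷-* m c e p s ⟨
        coeff m (((c , e) ∷ p) *ᴸ s)              ∎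

    coeff-distribʳ : ∀ m p r s → coeff m ((p +ᴸ r) *ᴸ s) ≡ coeff m (p *ᴸ s) + coeff m (r *ᴸ s)
    coeff-distribʳ m []            r s = sym (+-identityˡ _)
    coeff-distribʳ m ((c , e) ∷ p) r s = begin
      coeff m (((c , e) ∷ p +ᴸ r) *ᴸ s)                               ≡⟨ coeff-∷-* m c e (p +ᴸ r) s ⟩
      c * coeff (m - e) s + coeff m ((p +ᴸ r) *ᴸ s)                   ≡⟨ cong (c * coeff (m - e) s +_) (coeff-distribʳ m p r s) ⟩
      c * coeff (m - e) s + (coeff m (p *ᴸ s) + coeff m (r *ᴸ s))     ≡⟨ +-assoc (c * coeff (m - e) s) _ _ ⟨
      c * coeff (m - e) s + coeff m (p *ᴸ s) + coeff m (r *ᴸ s)       ≡⟨ cong (_+ _) (coeff-∷-* m c e p s) ⟨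
      coeff m (((c , e) ∷ p) *ᴸ s) + coeff m (r *ᴸ s)                 ∎

    coeff-map-*-* : ∀ m c e r s → coeff m (map ((c , e) *ᴹ_) r *ᴸ s) ≡ c * coeff (m - e) (r *ᴸ s)
    coeff-map-*-* m c e []            s = sym (*-zeroʳ c)
    coeff-map-*-* m c e ((d , f) ∷ r) s = begin
      coeff m (((c * d , e + f) ∷ map ((c , e) *ᴹ_) r) *ᴸ s)
        ≡⟨ coeff-∷-* m (c * d) (e + f) (map ((c , e) *ᴹ_) r) s ⟩
      c * d * coeff (m - (e + f)) s + coeff m (map ((c , e) *ᴹ_) r *ᴸ s)
        ≡⟨ cong₂ _+_ (cong (λ k → c * d * coeff k s) (regroup m e f)) (coeff-map-*-* m c e r s) ⟩
      c * d * coeff (m - e - f) s + c * coeff (m - e) (r *ᴸ s)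
        ≡⟨ factor c d _ _ ⟩
      c * (d * coeff (m - e - f) s + coeff (m - e) (r *ᴸ s))
        ≡⟨ cong (c *_) (coeff-∷-* (m - e) d f r s) ⟨
      c * coeff (m - e) (((d , f) ∷ r) *ᴸ s)  ∎
      where
      regroup : ∀ m e f → m - (e + f) ≡ m - e - f
      regroup = solve-∀
      factor : ∀ c d x y → c * d * x + c * y ≡ c * (d * x + y)
      factor = solve-∀

    *ᴸ-assoc : ∀ p r s → (p *ᴸ r) *ᴸ s ≋ p *ᴸ (r *ᴸ s)
    *ᴸ-assoc p r s = mk≋ λ m → go m p
      where
      go : ∀ m p → coeff m ((p *ᴸ r) *ᴸ s) ≡ coeff m (p *ᴸ (r *ᴸ s))
      go m []            = refl
      go m ((c , e) ∷ p) = begin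
        coeff m ((map ((c , e) *ᴹ_) r +ᴸ p *ᴸ r) *ᴸ s)                            ≡⟨ coeff-distribʳ m (map ((c , e) *ᴹ_) r) (p *ᴸ r) s ⟩
        coeff m (map ((c , e) *ᴹ_) r *ᴸ s) + coeff m ((p *ᴸ r) *ᴸ s)              ≡⟨ cong₂ _+_ (coeff-map-*-* m c e r s) (go m p) ⟩
        c * coeff (m - e) (r *ᴸ s) + coeff m (p *ᴸ (r *ᴸ s))                      ≡⟨ coeff-∷-* m c e p (r *ᴸ s) ⟨
        coeff m (((c , e) ∷ p) *ᴸ (r *ᴸ s))                                       ∎

    *ᴸ-distribʳ : ∀ s p r → (p +ᴸ r) *ᴸ s ≋ p *ᴸ s +ᴸ r *ᴸ s
    *ᴸ-distribʳ s p r = mk≋ λ m → trans (coeff-distribʳ m p r s) (sym (coeff-+ m (p *ᴸ s) _))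

    ≋-refl : ∀ {p} → p ≋ p
    ≋-refl = mk≋ λ _ → refl

    ≋-sym : ∀ {p r} → p ≋ r → r ≋ p
    ≋-sym (mk≋ p≋r) = mk≋ λ m → sym (p≋r m)

    ≋-trans : ∀ {p r s} → p ≋ r → r ≋ s → p ≋ s
    ≋-trans (mk≋ p≋r) (mk≋ r≋s) = mk≋ λ m → trans (p≋r m) (r≋s m)

    +ᴸ-cong : ∀ {p p′ r r′} → p ≋ p′ → r ≋ r′ → p +ᴸ r ≋ p′ +ᴸ r′
    +ᴸ-cong {p} {p′} (mk≋ p≋p′) (mk≋ r≋r′) = mk≋ λ m →
      trans (coeff-+ m p _) (trans (cong₂ _+_ (p≋p′ m) (r≋r′ m)) (sym (coeff-+ m p′ _)))

    +ᴸ-comm : ∀ p r → p +ᴸ r ≋ r +ᴸ p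
    +ᴸ-comm p r = mk≋ λ m → trans (coeff-+ m p r) (trans (+-comm (coeff m p) _) (sym (coeff-+ m r p)))

    -ᴸ-inverseˡ : ∀ p → -ᴸ p +ᴸ p ≋ 0ᴸ
    -ᴸ-inverseˡ p = mk≋ λ m → trans (coeff-+ m (-ᴸ p) p) (trans (cong (_+ coeff m p) (coeff-neg m p)) (+-inverseˡ (coeff m p)))

    -- Equal polynomials can be represented by unrelated lists, so there is no induction on two left
    -- factors at once. Congruence on the right is carried over by commutativity.
    *ᴸ-cong : ∀ {p p′ r r′} → p ≋ p′ → r ≋ r′ → p *ᴸ r ≋ p′ *ᴸ r′
    *ᴸ-cong {p} {p′} {r} {r′} p≋p′ r≋r′ =
      ≋-trans (*ᴸ-congˡ p r≋r′) (≋-trans (*ᴸ-comm p r′) (≋-trans (*ᴸ-congˡ r′ p≋p′) (*ᴸ-comm r′ p′)))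

    *ᴸ-identityˡ : ∀ p → 1ᴸ *ᴸ p ≋ p
    *ᴸ-identityˡ p = mk≋ λ m → trans (coeff-∷-* m 1ℤ 0ℤ [] p)
      (trans (+-identityʳ _) (trans (*-identityˡ _) (cong (λ k → coeff k p) (+-identityʳ m))))

  laurentRing : CommutativeRing 0ℓ 0ℓ
  laurentRing = record
    { Carrier = Laurent
    ; _≈_ = _≋_
    ; _+_ = _+ᴸ_
    ; _*_ = _*ᴸ_
    ; -_ = -ᴸ_
    ; 0# = 0ᴸ
    ; 1# = 1ᴸ
    ; isCommutativeRing = record
      { isRing = record
        { +-isAbelianGroup = record
          { isGroup = record
            { isMonoid = record
              { isSemigroup = record
                { isMagma = record
                  { isEquivalence = record { refl = ≋-refl ; sym = ≋-sym ; trans = ≋-trans }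
                  ; ∙-cong = +ᴸ-cong
                  }
                ; assoc = λ p r s → ≋-reflexive (++-assoc p r s)
                }
              ; identity = (λ p → ≋-refl) , (λ p → ≋-reflexive (++-identityʳ p))
              }
            ; inverse = -ᴸ-inverseˡ , (λ p → ≋-trans (+ᴸ-comm p _) (-ᴸ-inverseˡ p))
            ; ⁻¹-cong = λ {p} {r} p≋r → mk≋ λ m → trans (coeff-neg m p) (trans (cong -_ (coeff-≡ p≋r m)) (sym (coeff-neg m r)))
            }
          ; comm = +ᴸ-comm
          }
        ; *-cong = *ᴸ-cong
        ; *-assoc = *ᴸ-assoc
        ; *-identity = *ᴸ-identityˡ , (λ p → ≋-trans (*ᴸ-comm p 1ᴸ) (*ᴸ-identityˡ p))
        ; distrib = (λ p r s → ≋-trans (*ᴸ-comm p _) (≋-trans (*ᴸ-distribʳ p r s) (+ᴸ-cong (*ᴸ-comm r p) (*ᴸ-comm s p)))) , *ᴸ-distribʳ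
        }
      ; *-comm = *ᴸ-comm
      }
    }
    where
    open import Data.List.Properties using (++-assoc; ++-identityʳ)
    ≋-reflexive : ∀ {p r} → p ≡ r → p ≋ r
    ≋-reflexive refl = ≋-refl

-- Formal power series, their truncations and inverses

module FormalSeries where
  open LaurentPolynomials
  open import Algebra.Properties.CommutativeSemigroup (CommutativeRing.+-commutativeSemigroup laurentRing)
    using (x∙yz≈y∙xz; interchange)
  open import Data.Fin.Base using (toℕ)
  open import Data.Integer.Base as ℤ using (ℤ; 1ℤ)
  open import Data.List.Base using ([]; _∷_; applyUpTo)
  open import Data.List.Properties using (map-applyUpTo; map-upTo)
  open import Data.Nat.Base as ℕ using (ℕ; zero; suc; _∸_; _≤_; _<_; z≤n; s≤s)
  import Data.Nat.Properties as ℕ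
  open import Data.Product.Base using (_,_)
  import Data.Vec.Base as Vec
  open import Function.Base using (_∘_; id)
  open import Level using (0ℓ)
  open import Relation.Binary.PropositionalEquality.Core as ≡ using (_≡_)

  open CommutativeRing laurentRing
  open import Relation.Binary.Reasoning.Setoid setoid

  infixl 6 _+ˢ_
  _+ˢ_ : Series → Series → Series
  (f +ˢ g) n = f n +ᴸ g n

  0ˢ : Series
  0ˢ _ = 0ᴸ

  -- Peeling off the term at i = 0 leaves a product with `f` shifted, so the ring laws become
  -- inductions on `n` for all `f`.
  *ˢ-suc : ∀ f g n → (f *ˢ g) (suc n) ≡ f 0 *ᴸ g (suc n) +ᴸ ((f ∘ suc) *ˢ g) n
  *ˢ-suc f g n = ≡.cong (λ xs → f 0 *ᴸ g (suc n) +ᴸ sumᴸ xs)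
    (≡.trans (map-applyUpTo suc (λ i → f i *ᴸ g (suc n ∸ i)) (suc n))
             (≡.sym (map-upTo (λ i → f (suc i) *ᴸ g (n ∸ i)) (suc n))))

  -- Agreement is asked for up to `n` only; this makes the product well defined modulo a power of q.
  *ˢ-cong : ∀ {f f′ g g′} n → (∀ {i} → i ≤ n → f i ≈ f′ i) → (∀ {i} → i ≤ n → g i ≈ g′ i) →
    (f *ˢ g) n ≈ (f′ *ˢ g′) n
  *ˢ-cong zero f≈f′ g≈g′ = +-congʳ (*-cong (f≈f′ z≤n) (g≈g′ z≤n))
  *ˢ-cong {f} {f′} {g} {g′} (suc n) f≈f′ g≈g′ = begin
    (f *ˢ g) (suc n)                                 ≡⟨ *ˢ-suc f g n ⟩
    f 0 *ᴸ g (suc n) +ᴸ ((f ∘ suc) *ˢ g) n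
      ≈⟨ +-cong (*-cong (f≈f′ z≤n) (g≈g′ ℕ.≤-refl)) (*ˢ-cong n (λ i≤n → f≈f′ (s≤s i≤n)) (λ i≤n → g≈g′ (ℕ.m≤n⇒m≤1+n i≤n))) ⟩
    f′ 0 *ᴸ g′ (suc n) +ᴸ ((f′ ∘ suc) *ˢ g′) n       ≡⟨ *ˢ-suc f′ g′ n ⟨
    (f′ *ˢ g′) (suc n)                               ∎

  *ˢ-vanishˡ : ∀ {f} g n → (∀ {i} → i ≤ n → f i ≈ 0#) → (f *ˢ g) n ≈ 0#
  *ˢ-vanishˡ g n f≈0 = trans (*ˢ-cong {g = g} n f≈0 (λ _ → refl)) (zero* n)
    where
    zero* : ∀ n → (0ˢ *ˢ g) n ≈ 0#
    zero* zero    = refl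
    zero* (suc n) = trans (reflexive (*ˢ-suc 0ˢ g n)) (zero* n)

  private
    *ˢ-distribʳ : ∀ f g h n → ((g +ˢ h) *ˢ f) n ≈ (g *ˢ f +ˢ h *ˢ f) n
    *ˢ-distribʳ f g h zero = begin
      (g 0 + h 0) * f 0 + 0#               ≈⟨ +-identityʳ _ ⟩
      (g 0 + h 0) * f 0                    ≈⟨ distribʳ (f 0) (g 0) (h 0) ⟩
      g 0 * f 0 + h 0 * f 0                ≈⟨ +-cong (+-identityʳ (g 0 * f 0)) (+-identityʳ (h 0 * f 0)) ⟨
      g 0 * f 0 + 0# + (h 0 * f 0 + 0#)    ∎
    *ˢ-distribʳ f g h (suc n) = begin
      ((g +ˢ h) *ˢ f) (suc n)
        ≡⟨ *ˢ-suc (g +ˢ h) f n ⟩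
      (g 0 + h 0) * f (suc n) + ((g ∘ suc +ˢ h ∘ suc) *ˢ f) n
        ≈⟨ +-cong (distribʳ (f (suc n)) (g 0) (h 0)) (*ˢ-distribʳ f (g ∘ suc) (h ∘ suc) n) ⟩
      g 0 * f (suc n) + h 0 * f (suc n) + (((g ∘ suc) *ˢ f) n + ((h ∘ suc) *ˢ f) n)
        ≈⟨ interchange (g 0 * f (suc n)) (h 0 * f (suc n)) (((g ∘ suc) *ˢ f) n) (((h ∘ suc) *ˢ f) n) ⟩
      g 0 * f (suc n) + ((g ∘ suc) *ˢ f) n + (h 0 * f (suc n) + ((h ∘ suc) *ˢ f) n)
        ≡⟨ ≡.cong₂ _+_ (*ˢ-suc g f n) (*ˢ-suc h f n) ⟨
      (g *ˢ f +ˢ h *ˢ f) (suc n)  ∎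

    *ˢ-scaleˡ : ∀ a f g n → ((λ i → a * f i) *ˢ g) n ≈ a * (f *ˢ g) n
    *ˢ-scaleˡ a f g zero = begin
      a * f 0 * g 0 + 0#      ≈⟨ +-identityʳ _ ⟩
      a * f 0 * g 0           ≈⟨ *-assoc a (f 0) (g 0) ⟩
      a * (f 0 * g 0)         ≈⟨ *-congˡ {a} (+-identityʳ _) ⟨
      a * (f 0 * g 0 + 0#)    ∎
    *ˢ-scaleˡ a f g (suc n) = begin
      ((λ i → a * f i) *ˢ g) (suc n)
        ≡⟨ *ˢ-suc (λ i → a * f i) g n ⟩
      a * f 0 * g (suc n) + ((λ i → a * f (suc i)) *ˢ g) n
        ≈⟨ +-cong (*-assoc a (f 0) (g (suc n))) (*ˢ-scaleˡ a (f ∘ suc) g n) ⟩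
      a * (f 0 * g (suc n)) + a * ((f ∘ suc) *ˢ g) n
        ≈⟨ distribˡ a (f 0 * g (suc n)) (((f ∘ suc) *ˢ g) n) ⟨
      a * (f 0 * g (suc n) + ((f ∘ suc) *ˢ g) n)
        ≡⟨ ≡.cong (a *_) (*ˢ-suc f g n) ⟨
      a * (f *ˢ g) (suc n)  ∎

    -- The mirror image of `*ˢ-suc`, peeling off the last term; commutativity compares the two.
    *ˢ-sucʳ : ∀ f g n → (f *ˢ g) (suc n) ≈ f (suc n) * g 0 + (f *ˢ (g ∘ suc)) n
    *ˢ-sucʳ f g zero = x∙yz≈y∙xz (f 0 * g 1) (f 1 * g 0) 0#
    *ˢ-sucʳ f g (suc n) = begin
      (f *ˢ g) (suc (suc n))
        ≡⟨ *ˢ-suc f g (suc n) ⟩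
      f 0 * g (suc (suc n)) + ((f ∘ suc) *ˢ g) (suc n)
        ≈⟨ +-congˡ {f 0 * g (suc (suc n))} (*ˢ-sucʳ (f ∘ suc) g n) ⟩
      f 0 * g (suc (suc n)) + (f (suc (suc n)) * g 0 + ((f ∘ suc) *ˢ (g ∘ suc)) n)
        ≈⟨ x∙yz≈y∙xz (f 0 * g (suc (suc n))) (f (suc (suc n)) * g 0) _ ⟩
      f (suc (suc n)) * g 0 + (f 0 * g (suc (suc n)) + ((f ∘ suc) *ˢ (g ∘ suc)) n)
        ≡⟨ ≡.cong (f (suc (suc n)) * g 0 +_) (*ˢ-suc f (g ∘ suc) n) ⟨
      f (suc (suc n)) * g 0 + (f *ˢ (g ∘ suc)) (suc n)  ∎

    *ˢ-comm : ∀ f g n → (f *ˢ g) n ≈ (g *ˢ f) n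
    *ˢ-comm f g zero    = +-congʳ (*-comm (f 0) (g 0))
    *ˢ-comm f g (suc n) = begin
      (f *ˢ g) (suc n)                            ≡⟨ *ˢ-suc f g n ⟩
      f 0 * g (suc n) + ((f ∘ suc) *ˢ g) n        ≈⟨ +-cong (*-comm (f 0) (g (suc n))) (*ˢ-comm (f ∘ suc) g n) ⟩
      g (suc n) * f 0 + (g *ˢ (f ∘ suc)) n        ≈⟨ *ˢ-sucʳ g f n ⟨
      (g *ˢ f) (suc n)                            ∎

    *ˢ-assoc : ∀ f g h n → ((f *ˢ g) *ˢ h) n ≈ (f *ˢ (g *ˢ h)) n
    *ˢ-assoc f g h zero = begin
      (f 0 * g 0 + 0#) * h 0 + 0#     ≈⟨ +-congʳ (*-congʳ {h 0} (+-identityʳ (f 0 * g 0))) ⟩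
      f 0 * g 0 * h 0 + 0#            ≈⟨ +-congʳ (*-assoc (f 0) (g 0) (h 0)) ⟩
      f 0 * (g 0 * h 0) + 0#          ≈⟨ +-congʳ (*-congˡ {f 0} (+-identityʳ _)) ⟨
      f 0 * (g 0 * h 0 + 0#) + 0#     ∎
    *ˢ-assoc f g h (suc n) = begin
      ((f *ˢ g) *ˢ h) (suc n)
        ≡⟨ *ˢ-suc (f *ˢ g) h n ⟩
      (f 0 * g 0 + 0#) * h (suc n) + (((f *ˢ g) ∘ suc) *ˢ h) n
        ≈⟨ +-cong (trans (*-congʳ {h (suc n)} (+-identityʳ (f 0 * g 0))) (*-assoc (f 0) (g 0) (h (suc n))))
                  (*ˢ-cong {g = h} n (λ {i} _ → reflexive (*ˢ-suc f g i)) (λ _ → refl)) ⟩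
      f 0 * (g 0 * h (suc n)) + (((λ i → f 0 * g (suc i)) +ˢ (f ∘ suc) *ˢ g) *ˢ h) n
        ≈⟨ +-congˡ {f 0 * (g 0 * h (suc n))} (*ˢ-distribʳ h (λ i → f 0 * g (suc i)) ((f ∘ suc) *ˢ g) n) ⟩
      f 0 * (g 0 * h (suc n)) + (((λ i → f 0 * g (suc i)) *ˢ h) n + (((f ∘ suc) *ˢ g) *ˢ h) n)
        ≈⟨ +-congˡ {f 0 * (g 0 * h (suc n))} (+-cong (*ˢ-scaleˡ (f 0) (g ∘ suc) h n) (*ˢ-assoc (f ∘ suc) g h n)) ⟩
      f 0 * (g 0 * h (suc n)) + (f 0 * ((g ∘ suc) *ˢ h) n + ((f ∘ suc) *ˢ (g *ˢ h)) n)
        ≈⟨ +-assoc (f 0 * (g 0 * h (suc n))) (f 0 * ((g ∘ suc) *ˢ h) n) _ ⟨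
      f 0 * (g 0 * h (suc n)) + f 0 * ((g ∘ suc) *ˢ h) n + ((f ∘ suc) *ˢ (g *ˢ h)) n
        ≈⟨ +-congʳ (distribˡ (f 0) (g 0 * h (suc n)) _) ⟨
      f 0 * (g 0 * h (suc n) + ((g ∘ suc) *ˢ h) n) + ((f ∘ suc) *ˢ (g *ˢ h)) n
        ≡⟨ ≡.cong (λ x → f 0 * x + ((f ∘ suc) *ˢ (g *ˢ h)) n) (*ˢ-suc g h n) ⟨
      f 0 * (g *ˢ h) (suc n) + ((f ∘ suc) *ˢ (g *ˢ h)) n
        ≡⟨ *ˢ-suc f (g *ˢ h) n ⟨
      (f *ˢ (g *ˢ h)) (suc n)  ∎

  const-*ˢ : ∀ a f n → (const a *ˢ f) n ≈ a * f n
  const-*ˢ a f zero    = +-identityʳ _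
  const-*ˢ a f (suc n) = begin
    (const a *ˢ f) (suc n)                     ≡⟨ *ˢ-suc (const a) f n ⟩
    a * f (suc n) + ((const a ∘ suc) *ˢ f) n   ≈⟨ +-congˡ {a * f (suc n)} (*ˢ-vanishˡ f n (λ _ → refl)) ⟩
    a * f (suc n) + 0#                         ≈⟨ +-identityʳ _ ⟩
    a * f (suc n)                              ∎

  private
    *ˢ-identityˡ : ∀ f n → (1ˢ *ˢ f) n ≈ f n
    *ˢ-identityˡ f n = trans (const-*ˢ 1ᴸ f n) (*-identityˡ (f n))

  infix 4 _≈⟨mod_⟩_
  record _≈⟨mod_⟩_ (f : Series) (N : ℕ) (g : Series) : Set where
    constructor mk≈
    field at : ∀ {n} → n ≤ N → f n ≋ g n
  open _≈⟨mod_⟩_ public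

  -- ℤ[z, z⁻¹][[q]] / (q^(N+1))
  truncatedRing : ℕ → CommutativeRing 0ℓ 0ℓ
  truncatedRing N = record
    { Carrier = Series
    ; _≈_ = _≈⟨mod N ⟩_
    ; _+_ = _+ˢ_
    ; _*_ = _*ˢ_
    ; -_ = -ˢ_
    ; 0# = 0ˢ
    ; 1# = 1ˢ
    ; isCommutativeRing = record
      { isRing = record
        { +-isAbelianGroup = record
          { isGroup = record
            { isMonoid = record
              { isSemigroup = record
                { isMagma = record
                  { isEquivalence = record
                    { refl = mk≈ λ _ → refl
                    ; sym = λ e → mk≈ λ n≤N → sym (at e n≤N)
                    ; trans = λ e e′ → mk≈ λ n≤N → trans (at e n≤N) (at e′ n≤N)
                    }
                  ; ∙-cong = λ e e′ → mk≈ λ n≤N → +-cong (at e n≤N) (at e′ n≤N)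
                  }
                ; assoc = λ f g h → mk≈ λ {n} _ → +-assoc (f n) (g n) (h n)
                }
              ; identity = (λ f → mk≈ λ {n} _ → +-identityˡ (f n)) , (λ f → mk≈ λ {n} _ → +-identityʳ (f n))
              }
            ; inverse = (λ f → mk≈ λ {n} _ → -‿inverseˡ (f n)) , (λ f → mk≈ λ {n} _ → -‿inverseʳ (f n))
            ; ⁻¹-cong = λ e → mk≈ λ n≤N → -‿cong (at e n≤N)
            }
          ; comm = λ f g → mk≈ λ {n} _ → +-comm (f n) (g n)
          }
        ; *-cong = λ e e′ → mk≈ λ {n} n≤N → *ˢ-cong n (λ i≤n → at e (ℕ.≤-trans i≤n n≤N)) (λ i≤n → at e′ (ℕ.≤-trans i≤n n≤N))
        ; *-assoc = λ f g h → mk≈ λ {n} _ → *ˢ-assoc f g h n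
        ; *-identity = (λ f → mk≈ λ {n} _ → *ˢ-identityˡ f n)
                     , (λ f → mk≈ λ {n} _ → trans (*ˢ-comm f 1ˢ n) (*ˢ-identityˡ f n))
        ; distrib = (λ f g h → mk≈ λ {n} _ → trans (*ˢ-comm f (g +ˢ h) n)
                      (trans (*ˢ-distribʳ f g h n) (+-cong (*ˢ-comm g f n) (*ˢ-comm h f n))))
                  , (λ f g h → mk≈ λ {n} _ → *ˢ-distribʳ f g h n)
        }
      ; *-comm = λ f g → mk≈ λ {n} _ → *ˢ-comm f g n
      }
    }

  inverse : Series → Series
  inverse f n = Vec.head (inverseCoeffs f n)

  private
    -- The index function `h` is general because `tabulate` shifts it at each step. The vector
    -- starts with the highest coefficient, hence `n ∸ i`.
    products : ∀ (F : ℕ → Laurent → Laurent) h f n →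
      Vec.toList (Vec.zipWith F (Vec.tabulate (h ∘ toℕ)) (inverseCoeffs f n)) ≡
      applyUpTo (λ i → F (h i) (inverse f (n ∸ i))) (suc n)
    products F h f zero    = ≡.refl
    products F h f (suc n) = ≡.cong (F (h 0) (inverse f (suc n)) ∷_) (products F (h ∘ suc) f n)

  *ˢ-inverse : ∀ f → f 0 ≈ 1# → ∀ n → (f *ˢ inverse f) n ≈ 1ˢ n
  *ˢ-inverse f f₀≈1 zero = begin
    f 0 * 1# + 0#   ≈⟨ +-identityʳ _ ⟩
    f 0 * 1#        ≈⟨ *-identityʳ (f 0) ⟩
    f 0             ≈⟨ f₀≈1 ⟩
    1#              ∎
  *ˢ-inverse f f₀≈1 (suc n) = begin
    (f *ˢ inverse f) (suc n)                                       ≡⟨ *ˢ-suc f (inverse f) n ⟩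
    f 0 * inverse f (suc n) + ((f ∘ suc) *ˢ inverse f) n           ≈⟨ +-congʳ (*-congʳ {inverse f (suc n)} f₀≈1) ⟩
    1# * inverse f (suc n) + ((f ∘ suc) *ˢ inverse f) n            ≈⟨ +-congʳ (*-identityˡ (inverse f (suc n))) ⟩
    inverse f (suc n) + ((f ∘ suc) *ˢ inverse f) n
      -- The recursion that defines the inverse makes its new coefficient minus the rest of the
      -- convolution.
      ≡⟨ ≡.cong (λ xs → (- sumᴸ xs) + ((f ∘ suc) *ˢ inverse f) n)
           (≡.trans (products (λ i g → f (suc i) *ᴸ g) id f n) (≡.sym (map-upTo (λ i → f (suc i) *ᴸ inverse f (n ∸ i)) (suc n)))) ⟩
    (- ((f ∘ suc) *ˢ inverse f) n) + ((f ∘ suc) *ˢ inverse f) n    ≈⟨ -‿inverseˡ (((f ∘ suc) *ˢ inverse f) n) ⟩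
    0#                                                             ∎

  -- The monomial zᵉ qˢ, the weight of a part `s` that contributes `e` to the statistic.
  mono : ℤ → ℕ → Series
  mono e zero            = const ((1ℤ , e) ∷ [])
  mono e (suc s) zero    = 0ᴸ
  mono e (suc s) (suc n) = mono e s n

  mono-*ˢ : ∀ e s f n → (mono e s *ˢ f) (s ℕ.+ n) ≈ ((1ℤ , e) ∷ []) * f n
  mono-*ˢ e zero    f n = const-*ˢ _ f n
  mono-*ˢ e (suc s) f n = trans (reflexive (*ˢ-suc (mono e (suc s)) f (s ℕ.+ n))) (mono-*ˢ e s f n)

  mono-vanish : ∀ e {s n} → n < s → mono e s n ≈ 0#
  mono-vanish e {suc s} {zero}  _         = refl
  mono-vanish e {suc s} {suc n} (s≤s n<s) = mono-vanish e n<s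

  mono-*ˢ-vanish : ∀ e {s} f {n} → n < s → (mono e s *ˢ f) n ≈ 0#
  mono-*ˢ-vanish e {s} f {n} n<s = *ˢ-vanishˡ f n (λ i≤n → mono-vanish e (ℕ.≤-<-trans i≤n n<s))

  mono-*ˢ-mono : ∀ e s e′ s′ n → (mono e s *ˢ mono e′ s′) n ≈ mono (e ℤ.+ e′) (s ℕ.+ s′) n
  mono-*ˢ-mono e (suc s) e′ s′ zero    = refl
  mono-*ˢ-mono e (suc s) e′ s′ (suc n) = trans (reflexive (*ˢ-suc (mono e (suc s)) (mono e′ s′) n)) (mono-*ˢ-mono e s e′ s′ n)
  mono-*ˢ-mono e zero    e′ s′ n       = trans (const-*ˢ _ (mono e′ s′) n) (scale s′ n)
    where
    scale : ∀ s n → ((1ℤ , e) ∷ []) * mono e′ s n ≈ mono (e ℤ.+ e′) s n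
    scale zero    zero    = refl
    scale zero    (suc n) = refl
    scale (suc s) zero    = refl
    scale (suc s) (suc n) = scale s n

-- Generating functions backed by explicit enumerations

module GeneratingFunctions where
  open LaurentPolynomials
  open FormalSeries
  open import Data.Empty using (⊥)
  open import Data.Fin.Base using (Fin)
  open import Data.Integer.Base as ℤ using (ℤ; 1ℤ)
  import Data.Integer.Properties as ℤ
  open import Data.List.Base using (List; []; _∷_; _++_; map; filter; length; lookup)
  open import Data.List.Membership.Propositional using (_∈_)
  open import Data.List.Membership.Propositional.Properties
    using (∈-++⁺ˡ; ∈-++⁺ʳ; ∈-++⁻; ∈-map⁺; ∈-map⁻; ∈-filter⁺; ∈-filter⁻; ∈-lookup)
  open import Data.List.Properties using (map-++; map-cong-local)
  open import Data.List.Relation.Unary.All as All using (All; []; _∷_)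
  open import Data.List.Relation.Unary.Any as Any using (here; there)
  open import Data.List.Relation.Unary.Any.Properties using (lookup-index)
  open import Data.List.Relation.Unary.AllPairs using ([]; _∷_)
  open import Data.List.Relation.Unary.Unique.Propositional using (Unique)
  open import Data.List.Relation.Unary.Unique.Propositional.Properties using (map⁺; ++⁺; filter⁺)
  open import Data.Nat.Base as ℕ using (ℕ; suc; _∸_; _≤_; _<_)
  open import Data.Nat.Induction using (<-rec)
  import Data.Nat.Properties as ℕ
  open import Data.Product.Base using (∃-syntax; _×_; _,_; proj₁; proj₂)
  open import Data.Sum.Base as Sum using (_⊎_; [_,_]′)
  open import Function.Base using (_∘_)
  open import Function.Bundles using (_↔_; mk↔ₛ′)
  open import Relation.Binary.PropositionalEquality
    using (_≡_; refl; sym; trans; cong; cong₂; subst)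
  open import Relation.Nullary.Decidable using (yes; no)
  open import Relation.Nullary.Negation using (¬_; contradiction)

  private
    variable
      A B : Set
      P P′ R : A → Set
      stat stat′ : A → ℤ
      p r : Laurent

  open CommutativeRing laurentRing using ()
    renaming (refl to ≋-refl; sym to ≋-sym; trans to ≋-trans; +-cong to +ᴸ-cong; *-congˡ to *ᴸ-congˡ; reflexive to ≋-reflexive)

  weights : (A → ℤ) → List A → Laurent
  weights stat = map (λ a → 1ℤ , stat a)

  -- What is counted are the elements that satisfy `P`, not the proofs that they do, so `P` may be
  -- an inductive predicate with several derivations.
  record Enumeration (P : A → Set) (stat : A → ℤ) (p : Laurent) : Set where
    field
      elements : List A
      unique   : Unique elements
      sound    : ∀ {a} → a ∈ elements → P a
      complete : ∀ {a} → P a → a ∈ elements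
      weight   : p ≋ weights stat elements
  open Enumeration

  resp-≋ : p ≋ r → Enumeration P stat p → Enumeration P stat r
  resp-≋ p≋r E = record
    { elements = elements E ; unique = unique E ; sound = sound E ; complete = complete E
    ; weight = ≋-trans (≋-sym p≋r) (weight E) }

  restat : (∀ {a} → P a → stat a ≡ stat′ a) → Enumeration P stat p → Enumeration P stat′ p
  restat stat≡stat′ E = record
    { elements = elements E ; unique = unique E ; sound = sound E ; complete = complete E
    ; weight = ≋-trans (weight E) (≋-reflexive (map-cong-local (All.tabulate (cong (1ℤ ,_) ∘ stat≡stat′ ∘ sound E)))) }

  relabel : (∀ {a} → P a → R a) → (∀ {a} → R a → P a) → Enumeration P stat p → Enumeration R stat p
  relabel P⊆R R⊆P E = record
    { elements = elements E ; unique = unique E ; sound = P⊆R ∘ sound E ; complete = complete E ∘ R⊆P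
    ; weight = weight E }

  empty : (∀ {a} → ¬ P a) → Enumeration P stat 0ᴸ
  empty ¬P = record
    { elements = [] ; unique = [] ; sound = λ () ; complete = λ Pa → contradiction Pa ¬P ; weight = ≋-refl }

  singleton : ∀ a → P a → (∀ {b} → P b → b ≡ a) → Enumeration P stat ((1ℤ , stat a) ∷ [])
  singleton {P = P} a Pa only = record
    { elements = a ∷ [] ; unique = [] ∷ [] ; sound = λ { (here b≡a) → subst P (sym b≡a) Pa }
    ; complete = here ∘ only ; weight = ≋-refl }

  union : (∀ {a} → P a → P′ a → ⊥) → (∀ {a} → R a → P a ⊎ P′ a) → (∀ {a} → P a → R a) → (∀ {a} → P′ a → R a) →
    Enumeration P stat p → Enumeration P′ stat r → Enumeration R stat (p +ᴸ r)
  union {stat = stat} disjoint split inl inr E F = record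
    { elements = elements E ++ elements F
    ; unique   = ++⁺ (unique E) (unique F) (λ (∈E , ∈F) → disjoint (sound E ∈E) (sound F ∈F))
    ; sound    = [ inl ∘ sound E , inr ∘ sound F ]′ ∘ ∈-++⁻ (elements E)
    ; complete = [ ∈-++⁺ˡ ∘ complete E , ∈-++⁺ʳ (elements E) ∘ complete F ]′ ∘ split
    ; weight   = ≋-trans (+ᴸ-cong (weight E) (weight F))
                   (≋-reflexive (sym (map-++ (λ a → 1ℤ , stat a) (elements E) (elements F))))
    }

  image : ∀ (φ : A → B) e → (∀ {a b} → φ a ≡ φ b → a ≡ b) →
    (∀ {b} → R b → ∃[ a ] P a × b ≡ φ a) → (∀ {a} → P a → R (φ a)) →
    (∀ {a} → P a → stat′ (φ a) ≡ e ℤ.+ stat a) →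
    Enumeration P stat p → Enumeration R stat′ (((1ℤ , e) ∷ []) *ᴸ p)
  image {R = R} {stat′ = stat′} {stat = stat} φ e injective preimage inR stat-φ E = record
    { elements = map φ (elements E)
    ; unique   = map⁺ injective (unique E)
    ; sound    = λ b∈ → let a , a∈ , b≡φa = ∈-map⁻ φ b∈ in subst R (sym b≡φa) (inR (sound E a∈))
    ; complete = λ Rb → let a , Pa , b≡φa = preimage Rb in subst (_∈ map φ (elements E)) (sym b≡φa) (∈-map⁺ φ (complete E Pa))
    ; weight   = ≋-trans (*ᴸ-congˡ {(1ℤ , e) ∷ []} (weight E)) (≋-reflexive (go (elements E) (sound E)))
    }
    where
    go : ∀ xs → (∀ {a} → a ∈ xs → _) → ((1ℤ , e) ∷ []) *ᴸ weights stat xs ≡ weights stat′ (map φ xs)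
    go []       _     = refl
    go (x ∷ xs) xs⊆P = cong₂ _∷_ (cong (1ℤ ,_) (sym (stat-φ (xs⊆P (here refl))))) (go xs (xs⊆P ∘ there))

  coeff-weights : ∀ (stat : A → ℤ) m xs → coeff m (weights stat xs) ≡ ℤ.+ length (filter ((ℤ._≟ m) ∘ stat) xs)
  coeff-weights stat m []       = refl
  coeff-weights stat m (x ∷ xs) with stat x ℤ.≟ m
  ... | yes x≡m = cong (λ i → 1ℤ ℤ.+ i) (coeff-weights stat m xs)
  ... | no  x≢m = trans (ℤ.+-identityˡ _) (coeff-weights stat m xs)

  private
    lookup-injective : ∀ {xs : List A} → Unique xs → ∀ {i j} → lookup xs i ≡ lookup xs j → i ≡ j
    lookup-injective {xs = _ ∷ _}  _           {Fin.zero}  {Fin.zero}  _  = refl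
    lookup-injective {xs = _ ∷ xs} (x∉xs ∷ _)  {Fin.zero}  {Fin.suc j} eq = contradiction eq (All.lookup x∉xs (∈-lookup {xs = xs} j))
    lookup-injective {xs = _ ∷ xs} (x∉xs ∷ _)  {Fin.suc i} {Fin.zero}  eq = contradiction (sym eq) (All.lookup x∉xs (∈-lookup {xs = xs} i))
    lookup-injective {xs = _ ∷ _}  (_ ∷ u)     {Fin.suc i} {Fin.suc j} eq = cong Fin.suc (lookup-injective u eq)

  -- Meant for a `B` whose objects are bundled with proofs, while the enumeration lists bare data:
  -- `encode` forgets the proofs.
  count : Enumeration P stat p → ∀ m (encode : B → A) → (∀ {b c} → encode b ≡ encode c → b ≡ c) →
    (∀ b → P (encode b) × stat (encode b) ≡ m) → (∀ a → P a → stat a ≡ m → ∃[ b ] encode b ≡ a) →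
    ∃[ k ] ((Fin k ↔ B) × ℤ.+ k ≡ coeff m p)
  count {stat = stat} {B = B} E m encode injective valid decode =
    length selected , mk↔ₛ′ to from to-from from-to ,
    trans (sym (coeff-weights stat m (elements E))) (sym (coeff-≡ (weight E) m))
    where
    has-m? = (ℤ._≟ m) ∘ stat
    selected = filter has-m? (elements E)
    decoded : ∀ i → ∃[ b ] encode b ≡ lookup selected i
    decoded i = let a∈ , stat≡m = ∈-filter⁻ has-m? {xs = elements E} (∈-lookup {xs = selected} i)
                in decode _ (sound E a∈) stat≡m
    to : Fin (length selected) → B
    to i = proj₁ (decoded i)
    ∈selected : ∀ b → encode b ∈ selected
    ∈selected b = let Pb , stat≡m = valid b in ∈-filter⁺ has-m? (complete E Pb) stat≡m
    from : B → Fin (length selected)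
    from b = Any.index (∈selected b)
    to-from : ∀ b → to (from b) ≡ b
    to-from b = injective (trans (proj₂ (decoded (from b))) (sym (lookup-index (∈selected b))))
    from-to : ∀ i → from (to i) ≡ i
    from-to i = lookup-injective (filter⁺ has-m? (unique E))
      (trans (sym (lookup-index (∈selected (to i)))) (proj₂ (decoded i)))

  module _ {A : Set} (degree : A → ℕ) where

    GF : (A → Set) → (A → ℤ) → Series → Set
    GF P stat f = ∀ n → Enumeration (λ a → P a × degree a ≡ n) stat (f n)

  private
    variable
      degree degree′ : A → ℕ
      f g : Series

  gf-restat : (∀ {a} → P a → stat a ≡ stat′ a) → GF degree P stat f → GF degree P stat′ f
  gf-restat stat≡stat′ E n = restat (stat≡stat′ ∘ proj₁) (E n)

  gf-union : (∀ {a} → P a → P′ a → ⊥) → (∀ {a} → R a → P a ⊎ P′ a) → (∀ {a} → P a → R a) → (∀ {a} → P′ a → R a) →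
    GF degree P stat f → GF degree P′ stat g → GF degree R stat (f +ˢ g)
  gf-union disjoint split inl inr E F n = union
    (λ (Pa , _) (P′a , _) → disjoint Pa P′a)
    (λ (Ra , eq) → Sum.map (_, eq) (_, eq) (split Ra))
    (λ (Pa , eq) → inl Pa , eq) (λ (Pa , eq) → inr Pa , eq) (E n) (F n)

  gf-singleton : ∀ a → (∀ {b} → P b → b ≡ a) → P a → GF degree P stat (mono (stat a) (degree a))
  gf-singleton {P = P} {degree = degree} {stat = stat} a only Pa n = go (degree a) refl n
    where
    one : ∀ {s n} → degree a ≡ s → s ≡ n → Enumeration (λ b → P b × degree b ≡ n) stat ((1ℤ , stat a) ∷ [])
    one eq eq′ = singleton a (Pa , trans eq eq′) (only ∘ proj₁)
    none : ∀ {s n} → degree a ≡ s → ¬ s ≡ n → ∀ {b} → ¬ (P b × degree b ≡ n)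
    none refl s≢n (Pb , refl) = s≢n (cong degree (sym (only Pb)))
    mono-diag : ∀ e s → mono e s s ≡ (1ℤ , e) ∷ []
    mono-diag e 0       = refl
    mono-diag e (suc s) = mono-diag e s
    mono-off : ∀ e s n → ¬ s ≡ n → mono e s n ≡ 0ᴸ
    mono-off e 0       0       s≢n = contradiction refl s≢n
    mono-off e 0       (suc n) s≢n = refl
    mono-off e (suc s) 0       s≢n = refl
    mono-off e (suc s) (suc n) s≢n = mono-off e s n (s≢n ∘ cong suc)
    go : ∀ s → degree a ≡ s → ∀ n → Enumeration (λ b → P b × degree b ≡ n) stat (mono (stat a) s n)
    go s eq n with s ℕ.≟ n
    ... | yes refl = subst (Enumeration _ stat) (sym (mono-diag (stat a) s)) (one eq refl)
    ... | no  s≢n  = subst (Enumeration _ stat) (sym (mono-off (stat a) s n s≢n)) (empty (none eq s≢n))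

  module _ (φ : A → B) (e : ℤ) (s : ℕ) (injective : ∀ {a b} → φ a ≡ φ b → a ≡ b)
    (preimage : ∀ {b} → R b → ∃[ a ] P a × b ≡ φ a) (inR : ∀ {a} → P a → R (φ a))
    (degree-φ : ∀ {a} → P a → degree′ (φ a) ≡ s ℕ.+ degree a)
    (stat-φ : ∀ {a} → P a → stat′ (φ a) ≡ e ℤ.+ stat a) where

    shifted : ∀ k → Enumeration (λ a → P a × degree a ≡ k) stat (f k) →
      Enumeration (λ b → R b × degree′ b ≡ s ℕ.+ k) stat′ ((mono e s *ˢ f) (s ℕ.+ k))
    shifted {f = f} k E = resp-≋ (≋-sym (mono-*ˢ e s f k))
      (image φ e injective
        (λ (Rb , eq) → let a , Pa , b≡φa = preimage Rb in
          a , (Pa , ℕ.+-cancelˡ-≡ s _ _ (trans (sym (trans (cong degree′ b≡φa) (degree-φ Pa))) eq)) , b≡φa)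
        (λ (Pa , eq) → inR Pa , trans (degree-φ Pa) (cong (s ℕ.+_) eq))
        (λ (Pa , _) → stat-φ Pa)
        E)

    -- Asks for the enumeration only in the degree from which `φ` reaches `n`; within `gf-extend`
    -- nothing but smaller degrees is at hand.
    image-at : ∀ n → (∀ k → s ℕ.+ k ≡ n → Enumeration (λ a → P a × degree a ≡ k) stat (f k)) →
      Enumeration (λ b → R b × degree′ b ≡ n) stat′ ((mono e s *ˢ f) n)
    image-at {f = f} n E with s ℕ.≤? n
    ... | yes s≤n = subst (λ n → Enumeration (λ b → R b × degree′ b ≡ n) stat′ ((mono e s *ˢ f) n)) eq (shifted {f = f} (n ∸ s) (E (n ∸ s) eq))
      where eq = ℕ.m+[n∸m]≡n s≤n
    ... | no s≰n = resp-≋ (≋-sym (mono-*ˢ-vanish e f (ℕ.≰⇒> s≰n))) (empty λ (Rb , eq) →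
      let a , Pa , b≡φa = preimage Rb in
      s≰n (subst (s ≤_) (trans (sym (trans (cong degree′ b≡φa) (degree-φ Pa))) eq) (ℕ.m≤m+n s (degree a))))

    gf-image : GF degree P stat f → GF degree′ R stat′ (mono e s *ˢ f)
    gf-image E n = image-at n (λ k _ → E k)

  -- Everything in `P` arises from `R` by repeating `φ`, as when copies of one part are added. Since
  -- `0 < s`, the equation f = g + zᵉ qˢ f determines each degree from smaller ones, so recursion on
  -- the degree is well founded.
  gf-extend : ∀ (φ : A → A) e s → 0 < s → (∀ {a b} → φ a ≡ φ b → a ≡ b) →
    (∀ {a} → P a → ¬ R (φ a)) →
    (∀ {a} → P a → R a ⊎ (∃[ b ] P b × a ≡ φ b)) → (∀ {a} → R a → P a) → (∀ {a} → P a → P (φ a)) →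
    (∀ {a} → P a → degree (φ a) ≡ s ℕ.+ degree a) → (∀ {a} → P a → stat (φ a) ≡ e ℤ.+ stat a) →
    (∀ n → f n ≋ (g +ˢ mono e s *ˢ f) n) →
    GF degree R stat g → GF degree P stat f
  gf-extend {A = A} {P = P} {R = R} {degree = degree} {stat = stat} {f = f} {g = g}
    φ e s 0<s injective disjoint split inl inr degree-φ stat-φ f≈g+φf F = <-rec _ go
    where
    Image : A → Set
    Image a = ∃[ b ] P b × a ≡ φ b
    go : ∀ n → (∀ {k} → k < n → Enumeration (λ a → P a × degree a ≡ k) stat (f k)) → Enumeration (λ a → P a × degree a ≡ n) stat (f n)
    go n rec = resp-≋ (≋-sym (f≈g+φf n)) (union
      (λ { (Ra , _) ((b , Pb , refl) , _) → disjoint Pb Ra })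
      (λ (Pa , eq) → Sum.map (_, eq) (_, eq) (split Pa))
      (λ (Ra , eq) → inl Ra , eq)
      (λ { ((b , Pb , refl) , eq) → inr Pb , eq })
      (F n)
      (image-at {R = Image} φ e s injective (λ image → image) (λ Pa → _ , Pa , refl) degree-φ stat-φ n
        (λ k s+k≡n → rec (subst (k <_) s+k≡n (ℕ.m<n+m k 0<s)))))

-- Partitions by number of ones, and the crank

module Partitions where
  open LaurentPolynomials
  open FormalSeries
  open GeneratingFunctions
  open import Data.Bool.Base using (if_then_else_; true; false)
  open import Data.Integer.Base as ℤ using (ℤ; +_; 0ℤ; 1ℤ)
  import Data.Integer.Properties as ℤ
  open import Data.List.Base using (List; []; _∷_; map; filter; length; replicate)
  open import Data.List.Extrema.Nat using (max; max≤v⁺; v≤max⁺)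
  open import Data.List.Properties using (∷-injectiveʳ)
  open import Data.List.Relation.Unary.All as All using (All; []; _∷_)
  open import Data.List.Relation.Unary.Any using (here)
  open import Data.List.Relation.Unary.Linked as Linked using (Linked; []; [-]; _∷_)
  open import Data.Nat.Base as ℕ using (ℕ; zero; suc; _≤_; _<_; _≥_; s≤s; z≤n; s≤s⁻¹)
  open import Data.Nat.ListAction using (sum)
  import Data.Nat.Properties as ℕ
  open import Data.Product.Base using (∃-syntax; _×_; _,_)
  open import Data.Sum.Base using (inj₁; inj₂)
  open import Function.Base using (_∘_)
  open import Relation.Binary.PropositionalEquality using (_≡_; refl; sym; trans; cong; subst)
  open import Relation.Nullary.Decidable using (does)
  open import Relation.Nullary.Negation using (¬_; contradiction)

  geometric : ℤ → ℕ → Series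
  geometric e s = inverse (1ˢ -ˢ mono e s)

  module _ (N : ℕ) where
    open CommutativeRing (truncatedRing N) using (_≈_; _*_; _+_; _-_; 1#)
    open QSeries (truncatedRing N) using (*-inverse-cancel; *-inverse-unfold)

    geometric-inverse : ∀ e {s} → 0 < s → (1# - mono e s) * geometric e s ≈ 1#
    geometric-inverse e {suc s} _ = mk≈ λ {n} _ → *ˢ-inverse (1ˢ -ˢ mono e (suc s)) (mk≋ λ _ → refl) n

    *-geometric : ∀ f e {s} → 0 < s → f * geometric e s * (1# - mono e s) ≈ f
    *-geometric f e {s} 0<s = *-inverse-cancel f {1# - mono e s} {geometric e s} (geometric-inverse e 0<s)

    geometric-unfold : ∀ f e {s} → 0 < s → f * geometric e s ≈ f + mono e s * (f * geometric e s)
    geometric-unfold f e {s} 0<s = *-inverse-unfold f (mono e s) {geometric e s} (geometric-inverse e 0<s)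

  -- The partitions with exactly j ones and all parts at most k + 1.
  data Part (j : ℕ) : ℕ → List ℕ → Set where
    ones : Part j 0 (replicate j 1)
    skip : ∀ {k π} → Part j k π → Part j (suc k) π
    add  : ∀ {k π} → Part j (suc k) π → Part j (suc k) (suc (suc k) ∷ π)

  -- With Q = q², this is zᵉ Qʲ times the product of 1 / (1 - z^(u i) Qⁱ) over 2 ≤ i ≤ k + 1: each
  -- part `i` brings the statistic `u i`, and the `j` ones together bring `e`.
  partSeries : (ℕ → ℤ) → ℤ → ℕ → ℕ → Series
  partSeries u e j zero    = mono e (j ℕ.* 2)
  partSeries u e j (suc k) = partSeries u e j k *ˢ geometric (u (suc (suc k))) (suc (suc k) ℕ.* 2)

  part-≤ : ∀ {j k π} → Part j k π → All (_≤ suc k) π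
  part-≤ {j} ones  = replicate-≤ j
    where
    replicate-≤ : ∀ j → All (_≤ 1) (replicate j 1)
    replicate-≤ zero    = []
    replicate-≤ (suc j) = ℕ.≤-refl ∷ replicate-≤ j
  part-≤ (skip p) = All.map ℕ.m≤n⇒m≤1+n (part-≤ p)
  part-≤ (add p)  = ℕ.≤-refl ∷ part-≤ p

  part-ω : ∀ {j k π} → Part j k π → ω π ≡ j
  part-ω {j} ones = replicate-ω j
    where
    replicate-ω : ∀ j → ω (replicate j 1) ≡ j
    replicate-ω zero    = refl
    replicate-ω (suc j) = cong suc (replicate-ω j)
  part-ω (skip p) = part-ω p
  part-ω (add p)  = part-ω p

  private
    ∷-linked : ∀ {x π} → All (_≤ x) π → Linked _≥_ π → Linked _≥_ (x ∷ π)
    ∷-linked []         []          = [-]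
    ∷-linked (y≤x ∷ _)  linked      = y≤x ∷ linked

    linked-≤ : ∀ {x π} → Linked _≥_ (x ∷ π) → All (_≤ x) π
    linked-≤ [-]          = []
    linked-≤ (y≤x ∷ rest) = y≤x ∷ All.map (λ z≤y → ℕ.≤-trans z≤y y≤x) (linked-≤ rest)

  part-linked : ∀ {j k π} → Part j k π → Linked _≥_ π
  part-linked {j} ones = replicate-linked j
    where
    replicate-linked : ∀ j → Linked _≥_ (replicate j 1)
    replicate-linked 0             = []
    replicate-linked 1             = [-]
    replicate-linked (suc (suc j)) = ℕ.≤-refl ∷ replicate-linked (suc j)
  part-linked (skip p) = part-linked p
  part-linked (add p)  = ∷-linked (part-≤ p) (part-linked p)

  part-positive : ∀ {j k π} → Part j k π → All (0 <_) π
  part-positive {j} ones = replicate-positive j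
    where
    replicate-positive : ∀ j → All (0 <_) (replicate j 1)
    replicate-positive zero    = []
    replicate-positive (suc j) = s≤s z≤n ∷ replicate-positive j
  part-positive (skip p) = part-positive p
  part-positive (add p)  = s≤s z≤n ∷ part-positive p

  part-complete : ∀ k {π} → Linked _≥_ π → All (0 <_) π → All (_≤ suc k) π → Part (ω π) k π
  part-complete zero {π} _ π>0 π≤1 = subst (Part (ω π) 0) (sym (all-ones π>0 π≤1)) ones
    where
    all-ones : ∀ {π} → All (0 <_) π → All (_≤ 1) π → π ≡ replicate (ω π) 1
    all-ones []        []        = refl
    all-ones {1 ∷ π} (_ ∷ π>0) (_ ∷ π≤1) = cong (1 ∷_) (all-ones π>0 π≤1)
    all-ones {suc (suc x) ∷ π} (_ ∷ π>0) (s≤s () ∷ π≤1)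
  part-complete (suc k) {[]} linked [] [] = skip (part-complete k linked [] [])
  part-complete (suc k) {x ∷ π} linked (x>0 ∷ π>0) (x≤2+k ∷ π≤2+k) 
    with ℕ.m≤n⇒m<n∨m≡n x≤2+k | part-complete (suc k) (Linked.tail linked) π>0 π≤2+k
  ... | inj₂ refl  | p = add p
  ... | inj₁ x<2+k | _ = skip (part-complete k linked (x>0 ∷ π>0) (x≤1+k ∷ All.map (λ y≤x → ℕ.≤-trans y≤x x≤1+k) (linked-≤ linked)))
    where x≤1+k = s≤s⁻¹ x<2+k

  -- Parts are counted in q², so that π stands for its double.
  degree : List ℕ → ℕ
  degree π = sum π ℕ.* 2

  degree-replicate : ∀ j → degree (replicate j 1) ≡ j ℕ.* 2
  degree-replicate j = cong (ℕ._* 2) (go j)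
    where
    go : ∀ j → sum (replicate j 1) ≡ j
    go zero    = refl
    go (suc j) = cong suc (go j)

  -- Stated for any statistic additive over parts: it serves for the zero statistic as well as for
  -- `μ-stat j`.
  part-GF : ∀ {u : ℕ → ℤ} (stat : List ℕ → ℤ) → (∀ x π → stat (x ∷ π) ≡ u x ℤ.+ stat π) →
    ∀ j k → GF degree (Part j k) stat (partSeries u (stat (replicate j 1)) j k)
  part-GF stat stat-∷ j zero = subst (λ d → GF degree (Part j 0) stat (mono (stat (replicate j 1)) d)) (degree-replicate j)
    (gf-singleton (replicate j 1) (λ { ones → refl }) ones)
  part-GF {u} stat stat-∷ j (suc k) = gf-extend (suc (suc k) ∷_) (u (suc (suc k))) (suc (suc k) ℕ.* 2) (s≤s z≤n)
    ∷-injectiveʳ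
    (λ _ p → contradiction (All.head (part-≤ p)) ℕ.1+n≰n)
    (λ { (skip p) → inj₁ p ; (add p) → inj₂ (_ , p , refl) }) skip add
    (λ {π} _ → ℕ.*-distribʳ-+ 2 (suc (suc k)) (sum π)) (λ {π} _ → stat-∷ (suc (suc k)) π)
    (λ n → at (geometric-unfold n (partSeries u _ j k) _ (s≤s z≤n)) ℕ.≤-refl)
    (part-GF stat stat-∷ j k)

  -- The non-empty members of `Part 0 k`, presented by their largest part. It alone is the crank
  -- when there are no ones, so the parts below it go unweighted.
  data NoOnes : ℕ → List ℕ → Set where
    skip : ∀ {k π} → NoOnes k π → NoOnes (suc k) π
    add  : ∀ {k π} → Part 0 (suc k) π → NoOnes (suc k) (suc (suc k) ∷ π)

  noOnes-part : ∀ {k π} → NoOnes k π → Part 0 k π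
  noOnes-part (skip p) = skip (noOnes-part p)
  noOnes-part (add p)  = add p

  part-noOnes : ∀ {k x π} → Part 0 k (x ∷ π) → NoOnes k (x ∷ π)
  part-noOnes (skip p) = skip (part-noOnes p)
  part-noOnes (add p)  = add p

  unweighted : ℕ → Series
  unweighted k = partSeries (λ _ → 0ℤ) 0ℤ 0 k

  noOnesSeries : ℕ → Series
  noOnesSeries zero    = 0ˢ
  noOnesSeries (suc k) = noOnesSeries k +ˢ mono (+ suc (suc k)) (suc (suc k) ℕ.* 2) *ˢ unweighted (suc k)

  max-∷ : ∀ {x π} → All (_≤ x) π → max 0 (x ∷ π) ≡ x
  max-∷ {x} {π} π≤x = ℕ.≤-antisym (max≤v⁺ {x} {0} {x ∷ π} z≤n (ℕ.≤-refl ∷ π≤x)) (v≤max⁺ {x} 0 (x ∷ π) (inj₂ (here ℕ.≤-refl)))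

  crank-noOnes : ∀ {k π} → Part 0 (suc k) π → crank (suc (suc k) ∷ π) ≡ + suc (suc k)
  crank-noOnes {k} {π} p rewrite part-ω p = cong +_ (max-∷ (part-≤ p))

  noOnes-GF : ∀ k → GF degree (NoOnes k) crank (noOnesSeries k)
  noOnes-GF zero    n = empty λ ()
  noOnes-GF (suc k) = gf-union {P′ = λ π → ∃[ ρ ] Part 0 (suc k) ρ × π ≡ suc (suc k) ∷ ρ}
    (λ { p (_ , _ , refl) → contradiction (All.head (part-≤ (noOnes-part p))) ℕ.1+n≰n })
    (λ { (skip p) → inj₁ p ; (add p) → inj₂ (_ , p , refl) }) skip (λ { (_ , p , refl) → add p })
    (noOnes-GF k)
    (gf-image (suc (suc k) ∷_) (+ suc (suc k)) (suc (suc k) ℕ.* 2) ∷-injectiveʳ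
      (λ p → p) (λ p → _ , p , refl)
      (λ {π} _ → ℕ.*-distribʳ-+ 2 (suc (suc k)) (sum π))
      (λ p → trans (crank-noOnes p) (sym (ℤ.+-identityʳ _)))
      (part-GF (λ _ → 0ℤ) (λ _ _ → refl) 0 (suc k)))

  μ-weight : ℕ → ℕ → ℤ
  μ-weight j x = if does (j ℕ.<? x) then 1ℤ else 0ℤ

  -- The crank of a partition with `j` ones. Fixing `j` in advance keeps the threshold for large
  -- parts constant, which makes the statistic additive over parts.
  μ-stat : ℕ → List ℕ → ℤ
  μ-stat j π = + length (filter (j ℕ.<?_) π) ℤ.- + j

  μ-stat-∷ : ∀ j x π → μ-stat j (x ∷ π) ≡ μ-weight j x ℤ.+ μ-stat j π
  μ-stat-∷ j x π with j ℕ.<ᵇ x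
  ... | true  = ℤ.+-assoc 1ℤ (+ length (filter (j ℕ.<?_) π)) (ℤ.- + j)
  ... | false = sym (ℤ.+-identityˡ _)

  μ-stat-replicate : ∀ j → μ-stat (suc j) (replicate (suc j) 1) ≡ ℤ.- + suc j
  μ-stat-replicate j = trans (cong (λ k → + k ℤ.- + suc j) (go (suc j))) (ℤ.+-identityˡ _)
    where
    go : ∀ i → length (filter (suc j ℕ.<?_) (replicate i 1)) ≡ 0
    go zero    = refl
    go (suc i) = go i

  crank-ones : ∀ {j k π} → Part (suc j) k π → crank π ≡ μ-stat (suc j) π
  crank-ones p rewrite part-ω p = refl

  -- For j ≥ 1 this is z⁻ʲ Qʲ / ((Q²; Q)ⱼ₋₁ (z Qʲ⁺¹; Q)∞) with the factors for parts beyond k + 1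
  -- left out.
  onesSeries : ℕ → ℕ → Series
  onesSeries j = partSeries (μ-weight j) (ℤ.- + j) j

  ones-GF : ∀ j k → GF degree (Part (suc j) k) crank (onesSeries (suc j) k)
  ones-GF j k = gf-restat (sym ∘ crank-ones)
    (subst (λ e → GF degree (Part (suc j) k) (μ-stat (suc j)) (partSeries (μ-weight (suc j)) e (suc j) k)) (μ-stat-replicate j)
      (part-GF (μ-stat (suc j)) (μ-stat-∷ (suc j)) (suc j) k))

  -- The non-empty partitions with at most j ones and all parts at most k + 1.
  data Bounded (k : ℕ) : ℕ → List ℕ → Set where
    noOnes  : ∀ {π} → NoOnes k π → Bounded k 0 π
    fewer   : ∀ {j π} → Bounded k j π → Bounded k (suc j) π
    exactly : ∀ {j π} → Part (suc j) k π → Bounded k (suc j) π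

  bounded-ω : ∀ {k j π} → Bounded k j π → ω π ≤ j
  bounded-ω (noOnes p)  = ℕ.≤-reflexive (part-ω (noOnes-part p))
  bounded-ω (fewer b)   = ℕ.m≤n⇒m≤1+n (bounded-ω b)
  bounded-ω (exactly p) = ℕ.≤-reflexive (part-ω p)

  bounded-part : ∀ {k j π} → Bounded k j π → ∃[ i ] Part i k π
  bounded-part (noOnes p)  = 0 , noOnes-part p
  bounded-part (fewer b)   = bounded-part b
  bounded-part (exactly p) = _ , p

  ¬bounded-[] : ∀ {k j} → ¬ Bounded k j []
  ¬bounded-[] (noOnes p)  = ¬noOnes-[] p
    where
    ¬noOnes-[] : ∀ {k} → ¬ NoOnes k []
    ¬noOnes-[] (skip p) = ¬noOnes-[] p
  ¬bounded-[] (fewer b)   = ¬bounded-[] b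
  ¬bounded-[] (exactly p) = contradiction (part-ω p) λ ()

  part-bounded : ∀ {i k x π} j → i ≤ j → Part i k (x ∷ π) → Bounded k j (x ∷ π)
  part-bounded zero    z≤n p = noOnes (part-noOnes p)
  part-bounded (suc j) i≤1+j p with ℕ.m≤n⇒m<n∨m≡n i≤1+j
  ... | inj₁ i<1+j = fewer (part-bounded j (s≤s⁻¹ i<1+j) p)
  ... | inj₂ refl  = exactly p

  crankSeries : ℕ → ℕ → Series
  crankSeries k zero    = noOnesSeries k
  crankSeries k (suc j) = crankSeries k j +ˢ onesSeries (suc j) k

  bounded-GF : ∀ k j → GF degree (Bounded k j) crank (crankSeries k j)
  bounded-GF k zero    n = relabel (λ (p , eq) → noOnes p , eq) (λ { (noOnes p , eq) → p , eq }) (noOnes-GF k n)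
  bounded-GF k (suc j) = gf-union
    (λ b p → ℕ.1+n≰n (subst (_≤ j) (part-ω p) (bounded-ω b)))
    (λ { (fewer b) → inj₁ b ; (exactly p) → inj₂ p }) fewer exactly
    (bounded-GF k j) (ones-GF j k)

-- Distinct odd parts, the statistic θ, and pairs of partitions

module OddParts where
  open FormalSeries
  open GeneratingFunctions
  open Partitions
  open import Data.Bool.Base using (if_then_else_)
  open import Data.Integer.Base as ℤ using (ℤ; 0ℤ; 1ℤ)
  import Data.Integer.Properties as ℤ
  open import Data.List.Base using (List; []; _∷_)
  open import Data.List.Membership.DecPropositional using (_∈?_)
  open import Data.List.Properties using (∷-injectiveʳ)
  open import Data.List.Relation.Unary.All as All using (All; []; _∷_)
  open import Data.List.Relation.Unary.Any using (here; there)
  open import Data.List.Relation.Unary.Linked as Linked using (Linked; []; [-]; _∷_)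
  open import Data.Nat.Base using (ℕ; zero; suc; _+_; _*_; _≤_; _<_; _>_; s≤s; s≤s⁻¹)
  open import Data.Nat.Divisibility using (_∣_; _∤_; ∣m+n∣m⇒∣n; n∣m*n; ∣1⇒≡1)
  open import Data.Nat.ListAction using (sum)
  import Data.Nat.Properties as ℕ
  open import Data.Product.Base using (∃-syntax; _×_; _,_; proj₁; proj₂)
  open import Data.Sum.Base as Sum using (_⊎_; inj₁; inj₂)
  open import Function.Base using (_∘_)
  open import Relation.Binary.PropositionalEquality using (_≡_; refl; sym; trans; cong; cong₂; subst)
  open import Relation.Nullary.Decidable using (does; dec-true; dec-false)
  open import Relation.Nullary.Negation using (¬_; contradiction)

  -- Distinct odd parts below 2 k; each constructor step settles one odd number, that is, one factor
  -- of (-q; q²)ₖ.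
  data Odds : ℕ → List ℕ → Set where
    nil  : Odds 0 []
    skip : ∀ {k π} → Odds k π → Odds (suc k) π
    add  : ∀ {k π} → Odds k π → Odds (suc k) (suc (k * 2) ∷ π)

  odds-< : ∀ {k π} → Odds k π → All (_< k * 2) π
  odds-< nil      = []
  odds-< (skip p) = All.map (λ x<k → ℕ.m≤n⇒m≤o+n 2 x<k) (odds-< p)
  odds-< (add p)  = ℕ.≤-refl ∷ All.map (λ x<k → ℕ.m≤n⇒m≤o+n 2 x<k) (odds-< p)

  odds-linked : ∀ {k π} → Odds k π → Linked _>_ π
  odds-linked nil      = []
  odds-linked (skip p) = odds-linked p
  odds-linked (add p)  = ∷-linked (odds-< p) (odds-linked p)
    where
    ∷-linked : ∀ {x π} → All (_< x) π → Linked _>_ π → Linked _>_ (suc x ∷ π)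
    ∷-linked []         []     = [-]
    ∷-linked (y<x ∷ _)  linked = ℕ.m<n⇒m<1+n y<x ∷ linked

  odds-odd : ∀ {k π} → Odds k π → All (2 ∤_) π
  odds-odd nil      = []
  odds-odd (skip p) = odds-odd p
  odds-odd (add {k} p)  = odd ∷ odds-odd p
    where
    odd : 2 ∤ suc (k * 2)
    odd 2∣ = contradiction (∣1⇒≡1 (∣m+n∣m⇒∣n (subst (2 ∣_) (ℕ.+-comm 1 (k * 2)) 2∣) (n∣m*n k))) λ ()

  private
    tail-< : ∀ {x π} → Linked _>_ (x ∷ π) → All (_< x) π
    tail-< [-]            = []
    tail-< (x>y ∷ linked) = x>y ∷ All.map (λ z<y → ℕ.<-trans z<y x>y) (tail-< linked)

  odds-complete : ∀ k {π} → Linked _>_ π → All (2 ∤_) π → All (_< k * 2) π → Odds k π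
  odds-complete zero    {[]}    _      _             _             = nil
  odds-complete zero    {_ ∷ _} _      _             (() ∷ _)
  odds-complete (suc k) {[]}    linked []            []            = skip (odds-complete k linked [] [])
  odds-complete (suc k) {x ∷ π} linked (2∤x ∷ π-odd) (x<2+2k ∷ _)
    with ℕ.m≤n⇒m<n∨m≡n (s≤s⁻¹ x<2+2k)
  ... | inj₂ refl = add (odds-complete k (Linked.tail linked) π-odd
                      (All.zipWith (λ (y<1+2k , 2∤y) → odd-< (s≤s⁻¹ y<1+2k) 2∤y) (tail-< linked , π-odd)))
    where
    odd-< : ∀ {y} → y ≤ k * 2 → 2 ∤ y → y < k * 2
    odd-< y≤2k 2∤y = ℕ.≤∧≢⇒< y≤2k λ { refl → 2∤y (n∣m*n k) }
  ... | inj₁ x<1+2k = skip (odds-complete k linked (2∤x ∷ π-odd) (x<2k ∷ All.map (λ y<x → ℕ.<-trans y<x x<2k) (tail-< linked)))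
    where
    x<2k : x < k * 2
    x<2k = ℕ.≤∧≢⇒< (s≤s⁻¹ x<1+2k) λ { refl → 2∤x (n∣m*n k) }

  -- A pair (π₁ , π) stands for the partition with odd parts π₁ and even parts 2 π.
  Pair : Set
  Pair = List ℕ × List ℕ

  pairDegree : Pair → ℕ
  pairDegree (π₁ , π) = sum π₁ + degree π

  -- This is (-q; q²)ₖ times `f`. The factor `1ˢ` in the base case is the `mono 0ℤ 0` that comes
  -- from pairing with the empty list.
  oddSeries : Series → ℕ → Series
  oddSeries f zero    = 1ˢ *ˢ f
  oddSeries f (suc k) = oddSeries f k +ˢ mono 0ℤ (suc (k * 2)) *ˢ oddSeries f k

  OddsWith : (List ℕ → Set) → ℕ → Pair → Set
  OddsWith X k (π₁ , π) = Odds k π₁ × X π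

  addOdd : ℕ → Pair → Pair
  addOdd x (π₁ , π) = x ∷ π₁ , π

  addOdd-injective : ∀ x {a b} → addOdd x a ≡ addOdd x b → a ≡ b
  addOdd-injective x eq = cong₂ _,_ (∷-injectiveʳ (cong proj₁ eq)) (cong proj₂ eq)

  pairDegree-addOdd : ∀ x a → pairDegree (addOdd x a) ≡ x + pairDegree a
  pairDegree-addOdd x (π₁ , π) = ℕ.+-assoc x (sum π₁) (degree π)

  ¬odds-∷ : ∀ {k π} → ¬ Odds k (suc (k * 2) ∷ π)
  ¬odds-∷ {k} p = contradiction (All.head (odds-< p)) (ℕ.<-asym (ℕ.n<1+n (k * 2)))

  odds-GF : ∀ {X stat f} → GF degree X stat f → ∀ k → GF pairDegree (OddsWith X k) (stat ∘ proj₂) (oddSeries f k)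
  odds-GF {stat = stat} F zero = gf-image ([] ,_) 0ℤ 0 (cong proj₂)
    (λ { (nil , Xπ) → _ , Xπ , refl }) (nil ,_) (λ _ → refl) (λ {π} _ → sym (ℤ.+-identityˡ (stat π))) F
  odds-GF {X} {stat} F (suc k) = gf-union {P′ = λ a → ∃[ b ] OddsWith X k b × a ≡ addOdd (suc (k * 2)) b}
    (λ { (p , _) (_ , _ , refl) → ¬odds-∷ p })
    (λ { (skip p , Xπ) → inj₁ (p , Xπ) ; (add p , Xπ) → inj₂ (_ , (p , Xπ) , refl) })
    (λ (p , Xπ) → skip p , Xπ) (λ { (_ , (p , Xπ) , refl) → add p , Xπ })
    (odds-GF F k)
    (gf-image (addOdd (suc (k * 2))) 0ℤ (suc (k * 2)) (addOdd-injective _) (λ b → b) (λ p → _ , p , refl)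
      (λ {a} _ → pairDegree-addOdd (suc (k * 2)) a) (λ {a} _ → sym (ℤ.+-identityˡ (stat (proj₂ a)))) (odds-GF F k))

  distinctSeries : ℕ → Series
  distinctSeries = oddSeries 1ˢ

  distinct-GF : ∀ k → GF pairDegree (OddsWith (_≡ []) k) (λ _ → 0ℤ) (distinctSeries k)
  distinct-GF = odds-GF (gf-singleton [] (λ eq → eq) refl)

  θ-≥5 : ∀ {x π} → 3 ≤ x → All (_≤ 2 + x) π → θ (2 + x ∷ π) ≡ (if does (_∈?_ ℕ._≟_ x (2 + x ∷ π)) then 0 else 1)
  θ-≥5 {x} {π} 3≤x π≤2+x rewrite max-∷ π≤2+x | dec-true (5 ℕ.≤? 2 + x) (s≤s (s≤s 3≤x)) = refl

  private
    θ-∉ : ∀ x {y π} → y ≡ 2 + x → 3 ≤ x → All (_< x) π → θ (y ∷ π) ≡ 1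
    θ-∉ x {π = π} refl 3≤x π<x = trans (θ-≥5 3≤x (All.map (λ y<x → ℕ.m≤n⇒m≤o+n 2 (ℕ.<⇒≤ y<x)) π<x))
      (cong (if_then 0 else 1) (dec-false (_∈?_ ℕ._≟_ x (2 + x ∷ π)) λ where
        (here eq)  → ℕ.m≢1+n+m x {1} eq
        (there ∈π) → ℕ.<-irrefl refl (All.lookup π<x ∈π)))

    θ-∈ : ∀ x {y π} → y ≡ 2 + x → 3 ≤ x → All (_< x) π → θ (y ∷ x ∷ π) ≡ 0
    θ-∈ x {π = π} refl 3≤x π<x = trans (θ-≥5 3≤x (ℕ.m≤n+m x 2 ∷ All.map (λ y<x → ℕ.m≤n⇒m≤o+n 2 (ℕ.<⇒≤ y<x)) π<x))
      (cong (if_then 0 else 1) (dec-true (_∈?_ ℕ._≟_ x (2 + x ∷ x ∷ π)) (there (here refl))))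

    3≤3+ : ∀ k → 3 ≤ suc (suc k * 2)
    3≤3+ k = ℕ.m≤m+n 3 (k * 2)

  -- Largest part 3 falls under the separate clause of `θ` and is settled by evaluation. From 5 on,
  -- all other parts are below 2 k, hence smaller than the largest part minus 2.
  θ-isolated : ∀ {k π} → Odds k π → θ (suc (suc k * 2) ∷ π) ≡ 1
  θ-isolated {zero}  nil = refl
  θ-isolated {suc k} p   = θ-∉ (suc (suc k * 2)) {suc (suc (suc k) * 2)} refl (3≤3+ k) (All.map ℕ.m<n⇒m<1+n (odds-< p))

  θ-adjacent : ∀ {k π} → Odds k π → θ (suc (suc k * 2) ∷ suc (k * 2) ∷ π) ≡ 0
  θ-adjacent {zero}  nil = refl
  θ-adjacent {suc k} p   = θ-∈ (suc (suc k * 2)) {suc (suc (suc k) * 2)} refl (3≤3+ k) (All.map ℕ.m<n⇒m<1+n (odds-< p))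

  -- A largest part 2 k + 3 is isolated if 2 k + 1 is not a part.
  θSeries : ℕ → Series
  θSeries zero    = 1ˢ +ˢ mono 0ℤ 1
  θSeries (suc k) = θSeries k
    +ˢ (mono 1ℤ (suc (suc k * 2)) *ˢ distinctSeries k
    +ˢ mono 0ℤ (suc (suc k * 2) + suc (k * 2)) *ˢ distinctSeries k)

  -- The base case admits the part 1, since `θ` is 0 when the largest part is 1; the distinction of
  -- isolated and adjacent starts at 3. A new largest part fixes `θ` by the presence of its
  -- predecessor alone, so the parts below are counted by `distinctSeries` and not by `θSeries`.
  θ-GF : ∀ k → GF pairDegree (OddsWith (_≡ []) (suc k)) (ℤ.+_ ∘ θ ∘ proj₁) (θSeries k)
  θ-GF zero = gf-union {P = _≡ ([] , [])} {P′ = _≡ (1 ∷ [] , [])}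
    (λ { refl () })
    (λ { (skip nil , refl) → inj₁ refl ; (add nil , refl) → inj₂ refl })
    (λ { refl → skip nil , refl }) (λ { refl → add nil , refl })
    (gf-singleton ([] , []) (λ eq → eq) refl) (gf-singleton (1 ∷ [] , []) (λ eq → eq) refl)
  θ-GF (suc k) = gf-union {P′ = λ a → Isolated a ⊎ Adjacent a}
    (λ { (p , _) (inj₁ (_ , _ , refl)) → ¬odds-∷ p ; (p , _) (inj₂ (_ , _ , refl)) → ¬odds-∷ p })
    (λ { (skip p , refl) → inj₁ (p , refl)
       ; (add (skip p) , refl) → inj₂ (inj₁ (_ , (p , refl) , refl))
       ; (add (add p) , refl) → inj₂ (inj₂ (_ , (p , refl) , refl)) })
    (λ (p , eq) → skip p , eq)
    (λ { (inj₁ (_ , (p , refl) , refl)) → add (skip p) , refl ; (inj₂ (_ , (p , refl) , refl)) → add (add p) , refl })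
    (θ-GF k)
    (gf-union (λ { (_ , (p , _) , refl) (_ , _ , refl) → ¬odds-∷ p }) (λ a → a) inj₁ inj₂
      (gf-image isolated 1ℤ (suc (suc k * 2)) (addOdd-injective _) (λ a → a) (λ p → _ , p , refl)
        (λ {a} _ → pairDegree-addOdd (suc (suc k * 2)) a)
        (λ (p , _) → cong ℤ.+_ (θ-isolated p)) (distinct-GF k))
      (gf-image adjacent 0ℤ (suc (suc k * 2) + suc (k * 2)) (addOdd-injective _ ∘ addOdd-injective _) (λ a → a) (λ p → _ , p , refl)
        (λ {a} _ → trans (pairDegree-addOdd (suc (suc k * 2)) (addOdd (suc (k * 2)) a))
          (trans (cong (suc (suc k * 2) +_) (pairDegree-addOdd (suc (k * 2)) a)) (sym (ℕ.+-assoc (suc (suc k * 2)) (suc (k * 2)) _))))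
        (λ (p , _) → cong ℤ.+_ (θ-adjacent p)) (distinct-GF k)))
    where
    isolated adjacent : Pair → Pair
    isolated = addOdd (suc (suc k * 2))
    adjacent = addOdd (suc (suc k * 2)) ∘ addOdd (suc (k * 2))
    Isolated Adjacent : Pair → Set
    Isolated a = ∃[ b ] OddsWith (_≡ []) k b × a ≡ isolated b
    Adjacent a = ∃[ b ] OddsWith (_≡ []) k b × a ≡ adjacent b

  pairCrank : Pair → ℤ
  pairCrank (π₁ , [])        = ℤ.+ θ π₁
  pairCrank (_  , π@(_ ∷ _)) = crank π

  pairs-GF : ∀ k j → GF pairDegree (OddsWith (λ π → π ≡ [] ⊎ Bounded k j π) (suc k)) pairCrank
    (θSeries k +ˢ oddSeries (crankSeries k j) (suc k))
  pairs-GF k j = gf-union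
    (λ { (_ , refl) (_ , b) → ¬bounded-[] b })
    (λ (p , X) → Sum.map (p ,_) (p ,_) X) (λ (p , eq) → p , inj₁ eq) (λ (p , b) → p , inj₂ b)
    (gf-restat (λ { (_ , refl) → refl }) (θ-GF k))
    (gf-restat (λ { {_ , []} (_ , b) → contradiction b ¬bounded-[] ; {_ , _ ∷ _} _ → refl }) (odds-GF (bounded-GF k j) (suc k)))

-- The abstract identities specialised to truncated series

module Truncation (N : ℕ) where
  open LaurentPolynomials using (_≋_; mk≋)
  open FormalSeries
  open Partitions
  open OddParts
  open import Data.Bool.Base using (if_then_else_)
  open import Data.Integer.Base as ℤ using (ℤ; 0ℤ; 1ℤ; -1ℤ)
  import Data.Integer.Properties as ℤ
  open import Data.Nat.Base as ℕ using (zero; suc; _<_; _≤_; s≤s; z≤n; _∸_)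
  import Data.Nat.Properties as ℕ
  open import Relation.Binary.PropositionalEquality.Core as ≡ using (_≡_)
  open import Relation.Nullary.Decidable using (dec-true; dec-false)

  open CommutativeRing (truncatedRing N) hiding (zero)
  open QSeries (truncatedRing N)
  open import Algebra.Properties.Semiring.Exp semiring using (_^_)
  open import Relation.Binary.Reasoning.Setoid setoid

  mono-* : ∀ e s e′ s′ → mono e s * mono e′ s′ ≈ mono (e ℤ.+ e′) (s ℕ.+ s′)
  mono-* e s e′ s′ = mk≈ λ {n} _ → mono-*ˢ-mono e s e′ s′ n

  mono-≈0 : ∀ e {s} → N < s → mono e s ≈ 0#
  mono-≈0 e N<s = mk≈ λ n≤N → mono-vanish e (ℕ.≤-<-trans n≤N N<s)

  mono-^ : ∀ {x e s} → x ≈ mono e s → ∀ k → x ^ k ≈ mono (ℤ.+ k ℤ.* e) (k ℕ.* s)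
  mono-^ x≈ zero = refl
  mono-^ {x} {e} {s} x≈ (suc k) = begin
    x * x ^ k                                         ≈⟨ *-cong x≈ (mono-^ x≈ k) ⟩
    mono e s * mono (ℤ.+ k ℤ.* e) (k ℕ.* s)           ≈⟨ mono-* e s (ℤ.+ k ℤ.* e) (k ℕ.* s) ⟩
    mono (e ℤ.+ ℤ.+ k ℤ.* e) (s ℕ.+ k ℕ.* s)          ≡⟨ ≡.cong (λ i → mono i (s ℕ.+ k ℕ.* s)) (ℤ.suc-* (ℤ.+ k) e) ⟨
    mono (ℤ.+ suc k ℤ.* e) (suc k ℕ.* s)              ∎

  q≈ : q ≈ mono 0ℤ 1
  q≈ = mk≈ λ {n} _ → go n
    where
    go : ∀ n → q n ≋ mono 0ℤ 1 n
    go 0             = mk≋ λ _ → ≡.refl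
    go 1             = mk≋ λ _ → ≡.refl
    go (suc (suc n)) = mk≋ λ _ → ≡.refl

  q²≈ : q² ≈ mono 0ℤ 2
  q²≈ = mono-^ {q} {0ℤ} {1} q≈ 2

  q²^ : ∀ k → q² ^ k ≈ mono 0ℤ (k ℕ.* 2)
  q²^ k = trans (mono-^ {q²} {0ℤ} {2} q²≈ k) (reflexive (≡.cong (λ e → mono e (k ℕ.* 2)) (ℤ.*-zeroʳ (ℤ.+ k))))

  zq²^ : ∀ k → (z * q²) ^ k ≈ mono (ℤ.+ k) (k ℕ.* 2)
  zq²^ k = trans (mono-^ {z * q²} {1ℤ} {2} (trans (*-congˡ {z} q²≈) (mono-* 1ℤ 0 0ℤ 2)) k) (reflexive (≡.cong (λ e → mono e (k ℕ.* 2)) (ℤ.*-identityʳ (ℤ.+ k))))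

  z⁻¹q²^ : ∀ k → (z⁻¹ * q²) ^ k ≈ mono (ℤ.- ℤ.+ k) (k ℕ.* 2)
  z⁻¹q²^ k = trans (mono-^ {z⁻¹ * q²} { -1ℤ} {2} (trans (*-congˡ {z⁻¹} q²≈) (mono-* -1ℤ 0 0ℤ 2)) k) (reflexive (≡.cong (λ e → mono e (k ℕ.* 2)) eq))
    where
    eq : ℤ.+ k ℤ.* -1ℤ ≡ ℤ.- ℤ.+ k
    eq = ≡.trans (ℤ.*-comm (ℤ.+ k) -1ℤ) (ℤ.-1*i≡-i (ℤ.+ k))

  zz⁻¹≈1 : z * z⁻¹ ≈ 1#
  zz⁻¹≈1 = mono-* 1ℤ 0 -1ℤ 0

  N<2k : ∀ {k} → N < k → N < k ℕ.* 2
  N<2k {k} N<k = ℕ.<-≤-trans N<k (ℕ.m≤m*n k 2)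

  q²-nilpotent : ∀ {k} → N < k → q² ^ k ≈ 0#
  q²-nilpotent {k} N<k = trans (q²^ k) (mono-≈0 0ℤ (N<2k N<k))

  ^≡^ˢ : ∀ f k → f ^ k ≡ f ^ˢ k
  ^≡^ˢ f zero    = ≡.refl
  ^≡^ˢ f (suc k) = ≡.cong (f *ˢ_) (^≡^ˢ f k)

  poch≡pochhammer : ∀ f g k → poch f g k ≡ pochhammer f g k
  poch≡pochhammer f g zero    = ≡.refl
  poch≡pochhammer f g (suc k) = ≡.cong₂ (λ p x → p *ˢ (1ˢ -ˢ f *ˢ x)) (poch≡pochhammer f g k) (^≡^ˢ g k)

  -- In `⟨_⨾_⟩∞` the number of factors grows with the coefficient; this allows one fixed number for
  -- a whole truncated series.
  pochhammer-stable : ∀ f {k} → N < k → pochhammer f q² k N ≋ pochhammer f q² (suc N) N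
  pochhammer-stable f {k} N<k = at {N = N} stable ℕ.≤-refl
    where
    stable : pochhammer f q² k ≈ pochhammer f q² (suc N)
    stable = begin
      pochhammer f q² k                       ≡⟨ poch≡pochhammer f q² k ⟨
      poch f q² k                             ≡⟨ ≡.cong (poch f q²) (ℕ.m∸n+n≡m N<k) ⟨
      poch f q² ((k ∸ suc N) ℕ.+ suc N)       ≈⟨ poch-stable f q² {suc N} (k ∸ suc N) (trans (*-congˡ {f} (q²-nilpotent ℕ.≤-refl)) (zeroʳ f)) ⟩
      poch f q² (suc N)                       ≡⟨ poch≡pochhammer f q² (suc N) ⟩
      pochhammer f q² (suc N)                 ∎

  1-zq²^ : ∀ k → 1# - z * q² * q² ^ k ≈ 1# - mono 1ℤ (suc k ℕ.* 2)
  1-zq²^ k = +-congˡ {1#} (-‿cong (begin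
    z * q² * q² ^ k                ≈⟨ *-cong (trans (*-congˡ {z} q²≈) (mono-* 1ℤ 0 0ℤ 2)) (q²^ k) ⟩
    mono 1ℤ 2 * mono 0ℤ (k ℕ.* 2)  ≈⟨ mono-* 1ℤ 2 0ℤ (k ℕ.* 2) ⟩
    mono 1ℤ (suc k ℕ.* 2)          ∎))

  -- Parts up to k + 1 do not exceed the number j + 1 of ones, so `μ` ignores them all.
  ones-small : ∀ {j k} → k ≤ j → onesSeries (suc j) k ≈ mono (ℤ.- ℤ.+ suc j) (suc j ℕ.* 2) * unweighted k
  ones-small {j} {zero}  _   = sym (*-identityʳ (onesSeries (suc j) zero))
  ones-small {j} {suc k} k<j = begin
    onesSeries (suc j) k * geometric (μ-weight (suc j) (suc (suc k))) s
      ≡⟨ ≡.cong (λ b → onesSeries (suc j) k * geometric (if b then 1ℤ else 0ℤ) s) (dec-false (suc j ℕ.<? suc (suc k)) (λ j<k → ℕ.<⇒≱ (ℕ.≤-pred j<k) k<j)) ⟩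
    onesSeries (suc j) k * geometric 0ℤ s
      ≈⟨ *-congʳ {geometric 0ℤ s} (ones-small (ℕ.<⇒≤ k<j)) ⟩
    mono (ℤ.- ℤ.+ suc j) (suc j ℕ.* 2) * unweighted k * geometric 0ℤ s
      ≈⟨ *-assoc (mono (ℤ.- ℤ.+ suc j) (suc j ℕ.* 2)) (unweighted k) (geometric 0ℤ s) ⟩
    mono (ℤ.- ℤ.+ suc j) (suc j ℕ.* 2) * (unweighted k * geometric 0ℤ s)  ∎
    where s = suc (suc k) ℕ.* 2

  -- Each part above the number of ones carries a factor z, and its geometric series cancels one
  -- factor of (z Q; Q)∞.
  ones-poch : ∀ {j} i → onesSeries (suc j) (i ℕ.+ j) * poch (z * q²) q² (suc (i ℕ.+ j)) ≈ onesSeries (suc j) j * poch (z * q²) q² (suc j)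
  ones-poch zero = refl
  ones-poch {j} (suc i) = begin
    f * geometric (μ-weight (suc j) (suc (suc k))) s * (p * (1# - z * q² * q² ^ suc k))
      ≡⟨ ≡.cong (λ b → f * geometric (if b then 1ℤ else 0ℤ) s * (p * (1# - z * q² * q² ^ suc k))) (dec-true (suc j ℕ.<? suc (suc k)) (s≤s (s≤s (ℕ.m≤n+m j i)))) ⟩
    f * geometric 1ℤ s * (p * (1# - z * q² * q² ^ suc k))
      ≈⟨ *-congˡ {f * geometric 1ℤ s} (trans (*-congˡ {p} (1-zq²^ (suc k))) (*-comm p (1# - mono 1ℤ s))) ⟩
    f * geometric 1ℤ s * ((1# - mono 1ℤ s) * p)
      ≈⟨ *-assoc (f * geometric 1ℤ s) (1# - mono 1ℤ s) p ⟨
    f * geometric 1ℤ s * (1# - mono 1ℤ s) * p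
      ≈⟨ *-congʳ {p} (*-geometric N f 1ℤ (s≤s z≤n)) ⟩
    f * p
      ≈⟨ ones-poch i ⟩
    onesSeries (suc j) j * poch (z * q²) q² (suc j)  ∎
    where
    k = i ℕ.+ j
    s = suc (suc k) ℕ.* 2
    f = onesSeries (suc j) k
    p = poch (z * q²) q² (suc k)

  -- `V` and `M` are indexed by the largest part allowed, which is one more than the index of the
  -- underlying series.
  V M P : ℕ → Series
  V k = unweighted (k ∸ 1)
  M k = noOnesSeries (k ∸ 1)
  P k = onesSeries k N

  V-step : ∀ j → V (suc (suc j)) * (1# - q² ^ suc (suc j)) ≈ V (suc j)
  V-step j = begin
    V (suc (suc j)) * (1# - q² ^ suc (suc j))               ≈⟨ *-congˡ {V (suc (suc j))} (+-congˡ {1#} (-‿cong (q²^ (suc (suc j))))) ⟩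
    V (suc (suc j)) * (1# - mono 0ℤ (suc (suc j) ℕ.* 2))    ≈⟨ *-geometric N (V (suc j)) 0ℤ (s≤s z≤n) ⟩
    V (suc j)                                               ∎
  M-step : ∀ j → M (suc (suc j)) ≈ M (suc j) + (z * q²) ^ suc (suc j) * V (suc (suc j))
  M-step j = +-congˡ {M (suc j)} (*-congʳ {V (suc (suc j))} (sym (zq²^ (suc (suc j)))))
  P-step : ∀ {j} → j < suc N → P (suc j) * poch (z * q²) q² (suc N) ≈ (z⁻¹ * q²) ^ suc j * V (suc j) * poch (z * q²) q² (suc j)
  P-step {j} (s≤s j≤N) = begin
    P (suc j) * poch (z * q²) q² (suc N)                                    ≡⟨ ≡.cong (λ n → onesSeries (suc j) n * poch (z * q²) q² (suc n)) (ℕ.m∸n+n≡m j≤N) ⟨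
    onesSeries (suc j) (N ∸ j ℕ.+ j) * poch (z * q²) q² (suc (N ∸ j ℕ.+ j)) ≈⟨ ones-poch (N ∸ j) ⟩
    onesSeries (suc j) j * poch (z * q²) q² (suc j)
      ≈⟨ *-congʳ {poch (z * q²) q² (suc j)} (trans (ones-small {j} ℕ.≤-refl) (*-congʳ {V (suc j)} (sym (z⁻¹q²^ (suc j))))) ⟩
    (z⁻¹ * q²) ^ suc j * V (suc j) * poch (z * q²) q² (suc j)               ∎

  -- Here `K` is `suc N`, the number of factors that `⟨_⨾_⟩∞` uses for the coefficient of qᴺ.
  module C = Crank q² z z⁻¹ zz⁻¹≈1 (suc N) (q²-nilpotent (s≤s (ℕ.n≤1+n N))) V M P refl V-step refl M-step P-step

  crankSeries≈ : ∀ j → crankSeries N j ≈ M (suc N) + ∑< j (λ i → P (suc i))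
  crankSeries≈ zero    = sym (+-identityʳ (noOnesSeries N))
  crankSeries≈ (suc j) = trans (+-congʳ {onesSeries (suc j) N} (crankSeries≈ j)) (+-assoc (M (suc N)) _ _)

-- The generating function of all pairs

module Total (N : ℕ) where
  open LaurentPolynomials using (laurentRing; _≋_; mk≋)
  open FormalSeries
  open Partitions
  open OddParts
  open Truncation N
  open import Data.Integer.Base using (0ℤ; 1ℤ)
  open import Data.Nat.Base as ℕ using (zero; suc; s≤s; z≤n)
  import Data.Nat.Properties as ℕ
  open import Relation.Binary.PropositionalEquality.Core as ≡ using (_≡_; _≢_)

  open CommutativeRing (truncatedRing N) hiding (zero)
  open QSeries (truncatedRing N)
  open import Algebra.Properties.Semiring.Exp semiring using (_^_)
  open import Relation.Binary.Reasoning.Setoid setoid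
  private module L = CommutativeRing laurentRing

  ⟨⟩∞≈poch : ∀ f → ⟨ f ⨾ q² ⟩∞ ≈ poch f q² (suc N)
  ⟨⟩∞≈poch f = begin
    -- Stability is applied at the truncation order `n` of the coefficient considered, with `suc N`
    -- as the larger number of factors.
    ⟨ f ⨾ q² ⟩∞              ≈⟨ mk≈ (λ {n} n≤N → L.sym (Truncation.pochhammer-stable n f (s≤s n≤N))) ⟩
    pochhammer f q² (suc N)  ≡⟨ poch≡pochhammer f q² (suc N) ⟨
    poch f q² (suc N)        ∎

  private
    p W X Y denominator numerator : Series
    p = poch (- q) q² (suc N)
    W = poch q² q² (suc N)
    X = poch (z * q²) q² (suc N)
    Y = poch (z⁻¹ * q²) q² (suc N)
    numerator = ⟨ -ˢ q ⨾ q² ⟩∞ * ⟨ q² ⨾ q² ⟩∞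
    denominator = ⟨ z *ˢ q² ⨾ q² ⟩∞ * ⟨ z⁻¹ *ˢ q² ⨾ q² ⟩∞

    denominator-inverse : X * Y * inverse denominator ≈ 1#
    denominator-inverse = begin
      X * Y * inverse denominator         ≈⟨ *-congʳ {inverse denominator} (*-cong (⟨⟩∞≈poch (z * q²)) (⟨⟩∞≈poch (z⁻¹ * q²))) ⟨
      denominator * inverse denominator   ≈⟨ mk≈ (λ {n} _ → *ˢ-inverse denominator (mk≋ λ _ → ≡.refl) n) ⟩
      1#                                  ∎

    x : ℕ → Series
    x k = mono 0ℤ (suc (k ℕ.* 2))

    x≈ : ∀ k → x k ≈ q * q² ^ k
    x≈ k = sym (trans (*-cong q≈ (q²^ k)) (mono-* 0ℤ 1 0ℤ (k ℕ.* 2)))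

    x-step : ∀ k → x (suc k) ≈ x k * q²
    x-step k = sym (trans (*-congˡ {x k} q²≈) (trans (mono-* 0ℤ (suc (k ℕ.* 2)) 0ℤ 2)
      (reflexive (≡.cong (mono 0ℤ) (ℕ.+-comm (suc (k ℕ.* 2)) 2)))))

    odd≈ : ∀ f k → oddSeries f k ≈ f * poch (- q) q² k
    odd≈ f = poch-unique q q² f (oddSeries f) x (*-identityˡ f) x≈ (λ k → refl)

    θ-step : ∀ k → θSeries (suc k) ≈ θSeries k + (z * x (suc k) * distinctSeries k + x (suc k) * x k * distinctSeries k)
    θ-step k = +-congˡ {θSeries k} (+-cong
      (*-congʳ {distinctSeries k} (sym (mono-* 1ℤ 0 0ℤ (suc (suc k ℕ.* 2)))))
      (*-congʳ {distinctSeries k} (sym (mono-* 0ℤ (suc (suc k ℕ.* 2)) 0ℤ (suc (k ℕ.* 2))))))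

    θ≈ : θSeries N + (z - 1#) * q² ≈ distinctSeries (suc N) + (z - 1#) * q² * distinctSeries N
    θ≈ = isolated-parts z q² distinctSeries θSeries x (*-identityˡ 1#) refl x-step (λ k → refl) θ-step N

    euler≈ : C.Euler.S (suc (suc N)) (z * q²) + ∑< (suc N) (λ j → P (suc j)) ≈ 1# - q² + z * q² + crankSeries N (suc N)
    euler≈ = begin
      C.Euler.S (suc (suc N)) (z * q²) + ∑< (suc N) (λ j → P (suc j))    ≈⟨ +-congʳ {∑< (suc N) (λ j → P (suc j))} (C.M≈ N) ⟩
      1# - q² + z * q² + M (suc N) + ∑< (suc N) (λ j → P (suc j))        ≈⟨ +-assoc (1# - q² + z * q²) (M (suc N)) _ ⟩
      1# - q² + z * q² + (M (suc N) + ∑< (suc N) (λ j → P (suc j)))      ≈⟨ +-congˡ {1# - q² + z * q²} (crankSeries≈ (suc N)) ⟨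
      1# - q² + z * q² + crankSeries N (suc N)                           ∎

  pairSeries : Series
  pairSeries = θSeries N + oddSeries (crankSeries N (suc N)) (suc N)

  total : pairSeries + (z - 1#) * q² ≈ M2GeneratingFunction
  total = begin
    pairSeries + (z - 1#) * q²
      ≈⟨ weighted-total {z} {q²} {θSeries N} {crankSeries N (suc N)} {oddSeries (crankSeries N (suc N)) (suc N)}
           {distinctSeries N} {distinctSeries (suc N)} {x N} {p}
           {C.Euler.S (suc (suc N)) (z * q²) + ∑< (suc N) (λ j → P (suc j))} {X} {Y} {W} {inverse denominator}
           -- `x N` is the weight of the part 2 N + 1, which exceeds the truncation order.
           θ≈ refl (mono-≈0 0ℤ (s≤s (ℕ.m≤m*n N 2))) (odd≈ 1# (suc N)) (odd≈ (crankSeries N (suc N)) (suc N))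
           euler≈ C.crank-identity denominator-inverse ⟩
    p * W * inverse denominator
      ≈⟨ *-congʳ {inverse denominator} (*-cong (⟨⟩∞≈poch (- q)) (⟨⟩∞≈poch q²)) ⟨
    numerator * inverse denominator  ∎

  -- The identity `total` holds in every degree, and its correction term is concentrated in degree
  -- 2.
  pairSeries≋ : N ≢ 2 → pairSeries N ≋ M2GeneratingFunction N
  pairSeries≋ N≢2 = L.trans (L.sym (L.+-identityʳ (pairSeries N)))
    (L.trans (L.+-congˡ {pairSeries N} (L.sym correction)) (at total ℕ.≤-refl))
    where
    correction : ((z - 1#) * q²) N ≋ 0ᴸ
    correction = L.trans (at (*-comm (z - 1#) q²) ℕ.≤-refl) (L.trans (at (*-congʳ {z - 1#} q²≈) ℕ.≤-refl) (go N N≢2))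
      where
      go : ∀ n → n ≢ 2 → (mono 0ℤ 2 *ˢ (z - 1#)) n ≋ 0ᴸ
      go 0 _ = mono-*ˢ-vanish 0ℤ {2} (z - 1#) {0} (s≤s z≤n)
      go 1 _ = mono-*ˢ-vanish 0ℤ {2} (z - 1#) {1} (s≤s (s≤s z≤n))
      go 2 n≢2 = contradiction ≡.refl n≢2
        where open import Relation.Nullary.Negation using (contradiction)
      go (suc (suc (suc n))) _ = mono-*ˢ 0ℤ 2 (z - 1#) (suc n)

-- Pairs in `POD × PE` as pairs of bare lists

module Encoding where
  open Partitions
  open OddParts
  open import Data.List.Base using (List; []; _∷_; map)
  open import Data.List.Properties using (map-id-local; map-∘; map-cong; map-id)
  open import Data.List.Relation.Unary.All as All using (All; []; _∷_)
  import Data.List.Relation.Unary.All.Properties as All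
  open import Data.List.Relation.Unary.Linked as Linked using (Linked)
  import Data.List.Relation.Unary.Linked.Properties as Linked
  open import Data.Nat.Base using (ℕ; suc; _+_; _*_; _/_; _≤_; _<_; _≥_; s≤s; z≤n)
  open import Data.Nat.Divisibility using (_∣_; divides; ∣⇒≤; n∣m*n)
  open import Data.Nat.DivMod using (m*n/n≡m; m/n*n≡m; /-monoˡ-≤; m/n≤m)
  open import Data.Nat.ListAction using (sum)
  import Data.Nat.Properties as ℕ
  open import Data.Product.Base using (∃-syntax; _×_; _,_; proj₁; proj₂)
  open import Data.Sum.Base using (_⊎_; inj₁; inj₂; [_,_]′)
  open import Function.Base using (_∘_)
  open import Relation.Binary.PropositionalEquality using (_≡_; refl; sym; trans; cong; cong₂)

  halve : POD × PE → Pair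
  halve (π₁ , π₂) = POD.parts π₁ , map (_/ 2) (PE.parts π₂)

  pairCrank-halve : ∀ π → pairCrank (halve π) ≡ M2crank π
  pairCrank-halve (_ , pe []      _ _ _) = refl
  pairCrank-halve (_ , pe (_ ∷ _) _ _ _) = refl

  pairDegree-halve : ∀ π → pairDegree (halve π) ≡ size π
  pairDegree-halve (π₁ , pe π₂ _ _ even) = cong (sum (POD.parts π₁) +_) (go even)
    where
    go : ∀ {π} → All (2 ∣_) π → degree (map (_/ 2) π) ≡ sum π
    go [] = refl
    go {x ∷ π} (2∣x ∷ even) = trans (ℕ.*-distribʳ-+ 2 (x / 2) _) (cong₂ _+_ (m/n*n≡m 2∣x) (go even))

  private
    -- Needed because partitions with the same parts must be equal including their proofs; the
    -- quotient by 2 is determined by `n`.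
    ∣-irrelevant : ∀ {n} (p r : 2 ∣ n) → p ≡ r
    ∣-irrelevant (divides i n≡i*2) (divides j n≡j*2) with refl ← ℕ.*-cancelʳ-≡ i j 2 (trans (sym n≡i*2) n≡j*2) =
      cong (divides i) (ℕ.≡-irrelevant n≡i*2 n≡j*2)

    pod-≡ : ∀ {π ρ} → POD.parts π ≡ POD.parts ρ → π ≡ ρ
    pod-≡ {pod π d o} {pod ρ d′ o′} refl = cong₂ (pod π) (Linked.irrelevant ℕ.≤-irrelevant d d′) (All.irrelevant (λ _ _ → refl) o o′)

    pe-≡ : ∀ {π ρ} → PE.parts π ≡ PE.parts ρ → π ≡ ρ
    pe-≡ {pe π d p e} {pe ρ d′ p′ e′} refl
      with refl ← Linked.irrelevant ℕ.≤-irrelevant d d′ | refl ← All.irrelevant ℕ.≤-irrelevant p p′ =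
      cong (pe π d p) (All.irrelevant ∣-irrelevant e e′)

    double-halve : ∀ {π} → All (2 ∣_) π → map (_* 2) (map (_/ 2) π) ≡ π
    double-halve {π} even = trans (sym (map-∘ π)) (map-id-local (All.map m/n*n≡m even))

    halve-double : ∀ π → map (_/ 2) (map (_* 2) π) ≡ π
    halve-double π = trans (sym (map-∘ π)) (trans (map-cong (λ x → m*n/n≡m x 2) π) (map-id π))

  halve-injective : ∀ {π ρ} → halve π ≡ halve ρ → π ≡ ρ
  halve-injective {π₁ , π₂} {ρ₁ , ρ₂} eq = cong₂ _,_ (pod-≡ (cong proj₁ eq))
    (pe-≡ (trans (sym (double-halve (PE.even π₂))) (trans (cong (map (_* 2) ∘ proj₂) eq) (double-halve (PE.even ρ₂)))))

  private
    parts≤sum : ∀ π → All (_≤ sum π) π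
    parts≤sum []      = []
    parts≤sum (x ∷ π) = ℕ.m≤m+n x (sum π) ∷ All.map (ℕ.m≤n⇒m≤o+n x) (parts≤sum π)

    ω≤sum : ∀ π → ω π ≤ sum π
    ω≤sum []      = z≤n
    ω≤sum (0 ∷ π) = ω≤sum π
    ω≤sum (1 ∷ π) = s≤s (ω≤sum π)
    ω≤sum (suc (suc x) ∷ π) = ℕ.m≤n⇒m≤o+n (suc (suc x)) (ω≤sum π)

  -- The bounds exclude no pair of degree `n`, and they are those built into `pairSeries` at
  -- truncation order `n`.
  Encoded : ℕ → Pair → Set
  Encoded n = OddsWith (λ π → π ≡ [] ⊎ Bounded n (suc n) π) (suc n)

  halve-encoded : ∀ π → Encoded (size π) (halve π)
  halve-encoded (pod π₁ decreasing₁ odd , pe π₂ decreasing positive even) =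
    odds-complete (suc n) decreasing₁ odd (All.map (λ {x} x≤ → ℕ.≤-<-trans (ℕ.≤-trans x≤ (ℕ.m≤m+n (sum π₁) (sum π₂))) n<2+2n) (parts≤sum π₁)) ,
    evens π₂ decreasing positive even (ℕ.m≤n+m (sum π₂) (sum π₁))
    where
    n = sum π₁ + sum π₂
    n<2+2n : n < suc n * 2
    n<2+2n = ℕ.m≤m*n (suc n) 2
    evens : ∀ π → Linked _≥_ π → All (0 <_) π → All (2 ∣_) π → sum π ≤ n → map (_/ 2) π ≡ [] ⊎ Bounded n (suc n) (map (_/ 2) π)
    evens []        _          _        _    _   = inj₁ refl
    evens π@(_ ∷ _) decreasing positive even π≤n = inj₂ (part-bounded (suc n) (ℕ.≤-trans (ω≤sum ρ) (ℕ.≤-trans ρ≤n (ℕ.n≤1+n n)))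
      (part-complete n
        (Linked.map⁺ (Linked.map (λ x≥y → /-monoˡ-≤ 2 x≥y) decreasing))
        (All.map⁺ (All.zipWith half-positive (positive , even)))
        (All.map (λ x≤ → ℕ.≤-trans x≤ (ℕ.≤-trans ρ≤n (ℕ.n≤1+n n))) (parts≤sum ρ))))
      where
      ρ = map (_/ 2) π
      half-positive : ∀ {x} → 0 < x × 2 ∣ x → 0 < x / 2
      half-positive {suc x} (_ , 2∣x) = /-monoˡ-≤ 2 (∣⇒≤ 2∣x)
      sum-half : ∀ π → sum (map (_/ 2) π) ≤ sum π
      sum-half []      = z≤n
      sum-half (x ∷ π) = ℕ.+-mono-≤ (m/n≤m x 2) (sum-half π)
      ρ≤n : sum ρ ≤ n
      ρ≤n = ℕ.≤-trans (sum-half π) π≤n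

  halve-surjective : ∀ {n} a → Encoded n a → ∃[ π ] halve π ≡ a
  halve-surjective (π₁ , π) (p , X) =
    (pod π₁ (odds-linked p) (odds-odd p) ,
     pe (map (_* 2) π) (Linked.map⁺ (Linked.map (ℕ.*-monoˡ-≤ 2) linked)) (All.map⁺ (All.map (ℕ.*-monoˡ-< 2) positive)) (All.map⁺ (All.universal (λ x → n∣m*n x) π))) ,
    cong (π₁ ,_) (halve-double π)
    where
    linked : Linked _≥_ π
    linked = [ (λ { refl → Linked.[] }) , (λ b → part-linked (proj₂ (bounded-part b))) ]′ X
    positive : All (0 <_) π
    positive = [ (λ { refl → [] }) , (λ b → part-positive (proj₂ (bounded-part b))) ]′ X

-- The count of partitions with given M2crank

open import Data.Fin.Base using (Fin)
open import Data.Integer.Base using (ℤ; +_)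
open import Data.Product.Base using (∃-syntax; _×_; _,_; proj₁)
open import Function.Bundles using (_↔_)
open import Relation.Binary.PropositionalEquality.Core using (_≡_; _≢_)

theorem4p1 : (n : ℕ) → n ≢ 2 → (m : ℤ) →
    ∃[ k ] ((Fin k ↔ PartitionsWithM2crank m n) × + k ≡ M2 m n)
-- The truncation order is the degree `n` itself, the highest one that survives.
theorem4p1 n n≢2 m = count (resp-≋ (Total.pairSeries≋ n n≢2) (pairs-GF n (suc n) n)) m (halve ∘ proj₁)
  injective valid surjective
  where
  open GeneratingFunctions using (count; resp-≋)
  open OddParts using (pairDegree; pairCrank; pairs-GF)
  open Encoding
  open import Axiom.UniquenessOfIdentityProofs using (module Decidable⇒UIP)
  open import Data.Nat.Base using (suc)
  import Data.Integer.Properties as ℤ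
  import Data.Nat.Properties as ℕ
  open import Function.Base using (_∘_)
  open import Relation.Binary.PropositionalEquality using (refl; sym; trans; cong; cong₂)

  injective : ∀ {b c : PartitionsWithM2crank m n} → halve (proj₁ b) ≡ halve (proj₁ c) → b ≡ c
  injective {π , s , c} {ρ , s′ , c′} eq with refl ← halve-injective {π} {ρ} eq =
    cong₂ (λ s c → π , s , c) (ℕ.≡-irrelevant s s′) (Decidable⇒UIP.≡-irrelevant ℤ._≟_ c c′)

  valid : ∀ (b : PartitionsWithM2crank m n) →
    (Encoded n (halve (proj₁ b)) × pairDegree (halve (proj₁ b)) ≡ n) × pairCrank (halve (proj₁ b)) ≡ m
  valid (π , refl , crank≡m) = (halve-encoded π , pairDegree-halve π) , trans (pairCrank-halve π) crank≡m

  surjective : ∀ a → Encoded n a × pairDegree a ≡ n → pairCrank a ≡ m → ∃[ b ] halve (proj₁ {B = λ π → size π ≡ n × M2crank π ≡ m} b) ≡ a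
  surjective a (e , degree≡n) crank≡m with π , refl ← halve-surjective a e =
    (π , trans (sym (pairDegree-halve π)) degree≡n , trans (sym (pairCrank-halve π)) crank≡m) , refl
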